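{- Let $\vdash$ be an algebraizable logic with equivalent algebraic semantics the quasivariety $\mathbf{Y}$, and let $f$ be a selector term. The map $\mathsf{QVar}^f$ is a dual isomorphism between the complete lattices $\Lambda^f(\vdash)$ and $\Xi^f(\mathbf{Y})$.
   Context: Let $\mathcal{L}$ be an algebraic language, $\mathsf{Prop}$ a fixed countably infinite set of variables, $Tm(\mathcal{L},\mathsf{Prop})$ the set of terms (formulas). A consequence relation on a set $C$ is a relation between subsets and elements of $C$ that is reflexive ($W\vdash a$ if $a\in W$) and satisfies cut (if $W\vdash v$ for all $v\in V$ and $V\vdash a$ then $W\vdash a$); all consequence relations are assumed finitary (if $W\vdash a$ then $V\vdash a$ for some finite $V\subseteq W$). A logic is a substitution-invariant consequence relation on $Tm(\mathcal{L},\mathsf{Prop})$. $\Lambda(\vdash)$ is the complete lattice of (finitary) logics extending $\vdash$. A quasivariety is a class of algebras closed under isomorphisms, subalgebras and reduced products; $\Xi(\mathbf{Y})$ is the lattice of subquasivarieties of $\mathbf{Y}$. For a class $\mathbf{K}$, $\Theta\vDash_{\mathbf{K}}\gamma\approx\delta$ means that every assignment into an algebra of $\mathbf{K}$ satisfying all equations in $\Theta$ satisfies $\gamma\approx\delta$. The logic $\vdash$ is algebraizable with equivalent algebraic semantics the quasivariety $\mathbf{Y}$ (of language $\mathcal{L}$), witnessed by a finite set $\mu(x)$ of equations in one variable and a finite set $\Delta(x,y)$ of formulas in two variables: (1) $\Gamma\vdash\phi$ iff $\mu[\Gamma]\vDash_{\mathbf{Y}}\mu(\phi)$; (2) $\Theta\vDash_{\mathbf{Y}}\gamma\approx\delta$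 iff $\Delta[\Theta]\vdash\Delta(\gamma,\delta)$; (3) $\phi\dashv\vdash\Delta[\mu(\phi)]$; (4) $\gamma\approx\delta$ and $\mu[\Delta(\gamma,\delta)]$ are $\vDash_{\mathbf{Y}}$-interderivable. Here $\mu[\Gamma]$ is the union of the sets $\mu(\psi)$ for $\psi\in\Gamma$, and $\Delta[\Theta]$ is the union of the sets $\Delta(\varepsilon,\upsilon)$ for $\varepsilon\approx\upsilon$ in $\Theta$. A unary term $f(x)$ of $\mathcal{L}$ is a selector term if it is idempotent, i.e. $f(f(x))\dashv\vdash f(x)$ (each of $f(f(x))$ and $f(x)$ is derivable from the other in $\vdash$). $\chi[f(\overline p)/\overline p]$ is the result of substituting $f(q)$ for each variable $q$ in $\chi$, and $\Gamma[f(\overline p)/\overline p]$ is defined elementwise. For $\vdash_*\in\Lambda(\vdash)$, $\vdash_*^f$ is defined by $\Gamma\vdash_*^f\phi$ iff $\Gamma[f(\overline p)/\overline p]\vdash_*\phi[f(\overline p)/\overline p]$. $\Lambda^f(\vdash)=\{\vdash_*^f:\ \vdash_*\in\Lambda(\vdash)\}$, the $\mathsf{PAt}$-$f$-logics ordered by inclusion (a complete lattice). For $\mathcal{A}\in\mathbf{Y}$, $\mathcal{A}^f=\{a\in A:f(a)=a\}$. For $\mathcal{A},\mathcal{B}\in\mathbf{Y}$, $\mathcal{B}\preceq_f\mathcal{A}$ ($\mathcal{A}$ is a core superalgebra of $\mathcal{B}$) means $\mathcal{B}$ is a subalgebra of $\mathcal{A}$ and $\mathcal{A}^f=\mathcal{B}^f$.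 For $\mathbf{K}\in\Xi(\mathbf{Y})$, $\mathbf{K}^\uparrow=\{\mathcal{A}\in\mathbf{Y}:\exists\mathcal{B}\in\mathbf{K},\ \mathcal{B}\preceq_f\mathcal{A}\}$. $\Xi^f(\mathbf{Y})=\{\mathbf{K}^\uparrow:\mathbf{K}\in\Xi(\mathbf{Y})\}$, the $\mathsf{PAt}$-$f$-quasivarieties ordered by inclusion (a complete lattice). $\mathcal{A}\vDash_f(\Gamma,\phi)$ means: for each $v:\mathsf{Prop}\to\mathcal{A}^f$, if $\mathcal{A},v\vDash\mu[\Gamma]$ then $\mathcal{A},v\vDash\mu(\phi)$. $\mathsf{QVar}^f(\vdash_s)=\{\mathcal{A}\in\mathbf{Y}:\mathcal{A}\vDash_f(\Gamma,\phi)\text{ for all }(\Gamma,\phi)\in{\vdash_s}\}$.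
   Formalization: The selector term f is additionally assumed to be idempotent as an identity, f(f(x)) ≈ f(x) in Y; with mere interderivability of f(f(x)) and f(x) the map QVar^f can fail to be injective. -}

module Defs where

open import Level using (_⊔_) renaming (suc to lsuc)
open import Data.Nat.Base using (ℕ; zero; suc)
open import Data.Fin.Base using (Fin; zero; suc)
open import Data.List.Base using (List; map)
open import Data.List.Membership.Propositional using () renaming (_∈_ to _∈ˡ_)
open import Data.List.Relation.Unary.All using (All)
open import Data.Product.Base using (Σ-syntax; ∃; ∃-syntax; _×_; _,_; proj₁; proj₂; uncurry)
open import Data.Vec.Base using (Vec; []; _∷_; lookup)
open import Data.Vec.Functional using (Vector)
open import Function.Base using (_∘_)
open import Function.Bundles using (_⇔_)
open import Function.Definitions using (Bijective)
open import Relation.Binary.Bundles using (Setoid; Poset)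
open import Relation.Binary.PropositionalEquality.Core using (_≡_)
open import Relation.Unary using (Pred; _∈_; _⊆_; _∩_; _≐_; ｛_｝)
open import Relation.Unary.Polymorphic using (∅; U)
open import Relation.Unary.Relation.Binary.Subset using (⊆-poset)
import Relation.Binary.Construct.On as On
open import Relation.Binary.Morphism.Structures using (IsOrderIsomorphism)

module _ {c ℓ₁ ℓ₂} (P : Poset c ℓ₁ ℓ₂) where
  open Poset P

  IsSupremum : Pred Carrier c → Carrier → Set (c ⊔ ℓ₂)
  IsSupremum S s = (∀ x → x ∈ S → x ≤ s) × (∀ u → (∀ x → x ∈ S → x ≤ u) → s ≤ u)

  IsInfimum : Pred Carrier c → Carrier → Set (c ⊔ ℓ₂)
  IsInfimum S i = (∀ x → x ∈ S → i ≤ x) × (∀ l → (∀ x → x ∈ S → l ≤ x) → l ≤ i)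

  IsCompleteLattice : Set (lsuc c ⊔ ℓ₂)
  IsCompleteLattice = (S : Pred Carrier c) → ∃ (IsSupremum S) × ∃ (IsInfimum S)

record IsConsequenceRelation {ℓ} {C : Set ℓ} (_⊢_ : Pred C ℓ → C → Set (lsuc ℓ)) : Set (lsuc ℓ) where
  field
    reflexive : ∀ {W a} → a ∈ W → W ⊢ a
    cut       : ∀ {W V a} → (∀ {v} → v ∈ V → W ⊢ v) → V ⊢ a → W ⊢ a
    finitary  : ∀ {W a} → W ⊢ a → ∃[ V ] All (_∈ W) V × (_∈ˡ V) ⊢ a

record Language ℓ : Set (lsuc ℓ) where
  field
    Op    : Set ℓ
    arity : Op → ℕ

module _ {ℓ} (𝓛 : Language ℓ) where
  open Language 𝓛

  data Term {x} (X : Set x) : Set (x ⊔ ℓ) where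
    var : X → Term X
    op  : (o : Op) → Vec (Term X) (arity o) → Term X

  -- The variables in Prop are numbered by ℕ.
  Formula : Set ℓ
  Formula = Term ℕ

  infix 7 _≈̇_

  record Equation {x} (X : Set x) : Set (x ⊔ ℓ) where
    constructor _≈̇_
    field
      lhs rhs : Term X

  -- Algebras are setoids with operations, so that quotients, and with them
  -- reduced products, exist. As usual, they are required to be nonempty.
  record Algebra : Set (lsuc ℓ) where
    field
      setoid : Setoid ℓ ℓ

    open Setoid setoid public using (Carrier; _≈_; isEquivalence)

    field
      ⟦_⟧      : (o : Op) → Vector Carrier (arity o) → Carrier
      ⟦⟧-cong  : ∀ o {as bs} → (∀ j → as j ≈ bs j) → ⟦ o ⟧ as ≈ ⟦ o ⟧ bs
      nonempty : Carrier

  Class : Set (lsuc (lsuc ℓ))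
  Class = Pred Algebra (lsuc ℓ)

  FormulaRel : Set (lsuc (lsuc ℓ))
  FormulaRel = Pred Formula ℓ → Formula → Set (lsuc ℓ)

module _ {ℓ} {𝓛 : Language ℓ} where
  open Language 𝓛
  open Algebra using (Carrier)

  infixl 30 _[_] _[_]* _[_]ᵉ _[_]ˢ

  mutual
    _[_] : ∀ {x y} {X : Set x} {Y : Set y} → Term 𝓛 X → (X → Term 𝓛 Y) → Term 𝓛 Y
    var x   [ σ ] = σ x
    op o ts [ σ ] = op o (ts [ σ ]*)

    _[_]* : ∀ {x y} {X : Set x} {Y : Set y} {n} → Vec (Term 𝓛 X) n → (X → Term 𝓛 Y) → Vec (Term 𝓛 Y) n
    []       [ σ ]* = []
    (t ∷ ts) [ σ ]* = t [ σ ] ∷ ts [ σ ]*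

  _[_]ᵉ : ∀ {x y} {X : Set x} {Y : Set y} → Equation 𝓛 X → (X → Term 𝓛 Y) → Equation 𝓛 Y
  (γ ≈̇ δ) [ σ ]ᵉ = γ [ σ ] ≈̇ δ [ σ ]

  Image : (Formula 𝓛 → Formula 𝓛) → Pred (Formula 𝓛) ℓ → Pred (Formula 𝓛) ℓ
  Image h Γ χ = ∃[ ψ ] ψ ∈ Γ × χ ≡ h ψ

  _[_]ˢ : Pred (Formula 𝓛) ℓ → (ℕ → Formula 𝓛) → Pred (Formula 𝓛) ℓ
  Γ [ σ ]ˢ = Image (_[ σ ]) Γ

  module _ (A : Algebra 𝓛) {x} {X : Set x} (v : X → Carrier A) where
    mutual
      eval : Term 𝓛 X → Carrier A
      eval (var x)   = v x
      eval (op o ts) = Algebra.⟦_⟧ A o (evals ts)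

      evals : ∀ {n} → Vec (Term 𝓛 X) n → Vector (Carrier A) n
      evals (t ∷ ts) zero    = eval t
      evals (t ∷ ts) (suc j) = evals ts j

  infix 4 _⊨⟨_⟩_

  _⊨⟨_⟩_ : (A : Algebra 𝓛) → ∀ {x} {X : Set x} → (X → Carrier A) → Equation 𝓛 X → Set ℓ
  A ⊨⟨ v ⟩ (γ ≈̇ δ) = Algebra._≈_ A (eval A v γ) (eval A v δ)

  infix 4 _⊨[_]_

  _⊨[_]_ : Pred (Equation 𝓛 ℕ) ℓ → Class 𝓛 → Equation 𝓛 ℕ → Set (lsuc ℓ)
  Θ ⊨[ K ] e = (A : Algebra 𝓛) → A ∈ K → (v : ℕ → Carrier A) →
               (∀ {e′} → e′ ∈ Θ → A ⊨⟨ v ⟩ e′) → A ⊨⟨ v ⟩ e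

  record _≅_ (A B : Algebra 𝓛) : Set ℓ where
    private
      module A = Algebra A
      module B = Algebra B
    field
      to        : A.Carrier → B.Carrier
      homo      : ∀ o as → to (A.⟦ o ⟧ as) B.≈ B.⟦ o ⟧ (to ∘ as)
      cong      : ∀ {a b} → a A.≈ b → to a B.≈ to b
      bijective : Bijective A._≈_ B._≈_ to

  record Subalgebra (A : Algebra 𝓛) : Set (lsuc ℓ) where
    open Algebra A using (_≈_; ⟦_⟧)
    field
      Universe : Pred (Carrier A) ℓ
      resp     : ∀ {a b} → a ≈ b → a ∈ Universe → b ∈ Universe
      closed   : ∀ o as → (∀ j → as j ∈ Universe) → ⟦ o ⟧ as ∈ Universe
      nonempty : ∃ Universe

    algebra : Algebra 𝓛
    algebra = record
      { setoid   = On.setoid (Algebra.setoid A) proj₁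
      ; ⟦_⟧      = λ o as → ⟦ o ⟧ (proj₁ ∘ as) , closed o (proj₁ ∘ as) (proj₂ ∘ as)
      ; ⟦⟧-cong  = λ o → Algebra.⟦⟧-cong A o
      ; nonempty = nonempty
      }

  -- Improper filters are allowed, so a class closed under reduced products
  -- contains a trivial algebra.
  record IsFilter {I : Set ℓ} (𝓕 : Pred (Pred I ℓ) ℓ) : Set (lsuc ℓ) where
    field
      full     : U ∈ 𝓕
      ∩-closed : ∀ {P Q} → P ∈ 𝓕 → Q ∈ 𝓕 → P ∩ Q ∈ 𝓕
      upward   : ∀ {P Q} → P ⊆ Q → P ∈ 𝓕 → Q ∈ 𝓕

    ⋂-closed : ∀ {n} {P : Fin n → Pred I ℓ} → (∀ j → P j ∈ 𝓕) → (λ i → ∀ j → i ∈ P j) ∈ 𝓕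
    ⋂-closed {zero}  h = upward (λ _ ()) full
    ⋂-closed {suc n} h =
      upward (λ { (p , ps) zero → p ; (p , ps) (suc j) → ps j })
             (∩-closed (h zero) (⋂-closed (h ∘ suc)))

  module _ {I : Set ℓ} {𝓕 : Pred (Pred I ℓ) ℓ} (isFilter : IsFilter 𝓕) (A : I → Algebra 𝓛) where
    private module A i = Algebra (A i)
    open IsFilter isFilter

    reducedProduct : Algebra 𝓛
    reducedProduct = record
      { setoid = record
        { Carrier       = ∀ i → A.Carrier i
        ; _≈_           = λ a b → (λ i → A._≈_ i (a i) (b i)) ∈ 𝓕
        ; isEquivalence = record
          { refl  = upward (λ {i} _ → Setoid.refl (A.setoid i)) full
          ; sym   = upward (λ {i} → Setoid.sym (A.setoid i))
          ; trans = λ p q → upward (λ {i} → uncurry (Setoid.trans (A.setoid i))) (∩-closed p q)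
          }
        }
      ; ⟦_⟧      = λ o as i → A.⟦_⟧ i o (λ j → as j i)
      ; ⟦⟧-cong  = λ o as≈bs → upward (λ {i} → A.⟦⟧-cong i o) (⋂-closed as≈bs)
      ; nonempty = A.nonempty
      }

  record IsQuasivariety (K : Class 𝓛) : Set (lsuc ℓ) where
    field
      iso-closed     : ∀ {A B} → A ≅ B → A ∈ K → B ∈ K
      sub-closed     : ∀ {A} → A ∈ K → (B : Subalgebra A) → Subalgebra.algebra B ∈ K
      product-closed : ∀ {I : Set ℓ} {𝓕 : Pred (Pred I ℓ) ℓ} (isFilter : IsFilter 𝓕) (A : I → Algebra 𝓛) →
                       (∀ i → A i ∈ K) → reducedProduct isFilter A ∈ K

  record IsLogic (_⊢_ : FormulaRel 𝓛) : Set (lsuc ℓ) where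
    field
      isConsequenceRelation  : IsConsequenceRelation _⊢_
      substitution-invariant : ∀ {Γ φ} (σ : ℕ → Formula 𝓛) → Γ ⊢ φ → Γ [ σ ]ˢ ⊢ φ [ σ ]

  -- The finite sets μ(x) and Δ(x,y) are lists; the variable x is the element
  -- of Fin 1, and x, y are the elements of Fin 2, in this order.
  infix 30 _⟨_⟩ᴱ _⟨_⟩ᵀ _[_]ᴱ _[_]ᵀ

  _⟨_⟩ᴱ : List (Equation 𝓛 (Fin 1)) → Formula 𝓛 → Pred (Equation 𝓛 ℕ) ℓ
  μ ⟨ φ ⟩ᴱ = λ e → e ∈ˡ map (_[ (λ _ → φ) ]ᵉ) μ

  _⟨_⟩ᵀ : List (Term 𝓛 (Fin 2)) → Equation 𝓛 ℕ → Pred (Formula 𝓛) ℓ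
  Δ ⟨ γ ≈̇ δ ⟩ᵀ = λ χ → χ ∈ˡ map (_[ lookup (γ ∷ δ ∷ []) ]) Δ

  _[_]ᴱ : List (Equation 𝓛 (Fin 1)) → Pred (Formula 𝓛) ℓ → Pred (Equation 𝓛 ℕ) ℓ
  μ [ Γ ]ᴱ = λ e → ∃[ ψ ] ψ ∈ Γ × e ∈ μ ⟨ ψ ⟩ᴱ

  _[_]ᵀ : List (Term 𝓛 (Fin 2)) → Pred (Equation 𝓛 ℕ) ℓ → Pred (Formula 𝓛) ℓ
  Δ [ Θ ]ᵀ = λ χ → ∃[ e ] e ∈ Θ × χ ∈ Δ ⟨ e ⟩ᵀ

  record IsAlgebraizable (_⊢_ : FormulaRel 𝓛) (Y : Class 𝓛)
                         (μ : List (Equation 𝓛 (Fin 1))) (Δ : List (Term 𝓛 (Fin 2))) : Set (lsuc ℓ) where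
    field
      ⊢⇔⊨ : ∀ Γ φ → Γ ⊢ φ ⇔ (∀ {e} → e ∈ μ ⟨ φ ⟩ᴱ → μ [ Γ ]ᴱ ⊨[ Y ] e)
      ⊨⇔⊢ : ∀ Θ e → Θ ⊨[ Y ] e ⇔ (∀ {χ} → χ ∈ Δ ⟨ e ⟩ᵀ → Δ [ Θ ]ᵀ ⊢ χ)
      ⊣⊢Δμ : ∀ φ → (∀ {χ} → χ ∈ Δ [ μ ⟨ φ ⟩ᴱ ]ᵀ → ｛ φ ｝ ⊢ χ) × (Δ [ μ ⟨ φ ⟩ᴱ ]ᵀ ⊢ φ)
      ⊨μΔ  : ∀ e → (∀ {e′} → e′ ∈ μ [ Δ ⟨ e ⟩ᵀ ]ᴱ → ｛ e ｝ ⊨[ Y ] e′) × (μ [ Δ ⟨ e ⟩ᵀ ]ᴱ ⊨[ Y ] e)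

  infix 30 _⟪_⟫

  _⟪_⟫ : Term 𝓛 (Fin 1) → Formula 𝓛 → Formula 𝓛
  f ⟪ t ⟫ = f [ (λ _ → t) ]

  IsSelector : FormulaRel 𝓛 → Term 𝓛 (Fin 1) → Set (lsuc ℓ)
  IsSelector _⊢_ f = ∀ p → (｛ f ⟪ f ⟪ var p ⟫ ⟫ ｝ ⊢ f ⟪ var p ⟫) × (｛ f ⟪ var p ⟫ ｝ ⊢ f ⟪ f ⟪ var p ⟫ ⟫)

  -- Idempotence as an identity of Y.  It implies IsSelector, but not
  -- conversely: f(f(x)) and f(x) may be interderivable without being equal.
  -- Then the set of fixed points of f need not be its range, and QVarᶠ need
  -- not be injective on Λᶠ.
  IsIdempotentIn : Class 𝓛 → Term 𝓛 (Fin 1) → Set (lsuc ℓ)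
  IsIdempotentIn Y f = ∀ p → ∅ ⊨[ Y ] f ⟪ f ⟪ var p ⟫ ⟫ ≈̇ f ⟪ var p ⟫

  Fixed : Term 𝓛 (Fin 1) → (A : Algebra 𝓛) → Pred (Carrier A) ℓ
  Fixed f A a = Algebra._≈_ A (eval A (λ _ → a) f) a

  -- The set Bᶠ is embedded in A by forgetting the proof of membership in B.
  IsCore : Term 𝓛 (Fin 1) → (A : Algebra 𝓛) → Subalgebra A → Set ℓ
  IsCore f A B = Fixed f A ≐ (λ a → Σ[ a∈B ∈ a ∈ Universe ] (a , a∈B) ∈ Fixed f algebra)
    where open Subalgebra B

  InΛ : FormulaRel 𝓛 → FormulaRel 𝓛 → Set (lsuc ℓ)
  InΛ _⊢_ _⊢*_ = IsLogic _⊢*_ × (∀ {Γ φ} → Γ ⊢ φ → Γ ⊢* φ)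

  infixl 30 _^[_]

  _^[_] : FormulaRel 𝓛 → Term 𝓛 (Fin 1) → FormulaRel 𝓛
  (_⊢*_ ^[ f ]) Γ φ = Γ [ (λ q → f ⟪ var q ⟫) ]ˢ ⊢* φ [ (λ q → f ⟪ var q ⟫) ]

  InΛᶠ : FormulaRel 𝓛 → Term 𝓛 (Fin 1) → FormulaRel 𝓛 → Set (lsuc (lsuc ℓ))
  InΛᶠ _⊢_ f _⊢ₛ_ = ∃[ ⊢* ] InΛ _⊢_ ⊢* × (∀ Γ φ → Γ ⊢ₛ φ ⇔ (⊢* ^[ f ]) Γ φ)

  Λᶠ : FormulaRel 𝓛 → Term 𝓛 (Fin 1) → Poset (lsuc (lsuc ℓ)) (lsuc ℓ) (lsuc ℓ)
  Λᶠ _⊢_ f = On.poset (⊆-poset (Pred (Formula 𝓛) ℓ × Formula 𝓛) (lsuc ℓ))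
                      (λ (s : ∃ (InΛᶠ _⊢_ f)) → uncurry (proj₁ s))

  InΞ : Class 𝓛 → Class 𝓛 → Set (lsuc ℓ)
  InΞ Y K = IsQuasivariety K × K ⊆ Y

  ↑ : Class 𝓛 → Term 𝓛 (Fin 1) → Class 𝓛 → Class 𝓛
  ↑ Y f K A = A ∈ Y × Σ[ B ∈ Subalgebra A ] Subalgebra.algebra B ∈ K × IsCore f A B

  InΞᶠ : Class 𝓛 → Term 𝓛 (Fin 1) → Class 𝓛 → Set (lsuc (lsuc ℓ))
  InΞᶠ Y f L = ∃[ K ] InΞ Y K × L ≐ ↑ Y f K

  Ξᶠ : Class 𝓛 → Term 𝓛 (Fin 1) → Poset (lsuc (lsuc ℓ)) (lsuc ℓ) (lsuc ℓ)
  Ξᶠ Y f = On.poset (⊆-poset (Algebra 𝓛) (lsuc ℓ)) (λ (L : ∃ (InΞᶠ Y f)) → proj₁ L)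

  Satisfiesᶠ : List (Equation 𝓛 (Fin 1)) → Term 𝓛 (Fin 1) →
               Algebra 𝓛 → Pred (Formula 𝓛) ℓ → Formula 𝓛 → Set ℓ
  Satisfiesᶠ μ f A Γ φ = (v : ℕ → Carrier A) → (∀ p → v p ∈ Fixed f A) →
    (∀ {e} → e ∈ μ [ Γ ]ᴱ → A ⊨⟨ v ⟩ e) → (∀ {e} → e ∈ μ ⟨ φ ⟩ᴱ → A ⊨⟨ v ⟩ e)

  QVarᶠ : Class 𝓛 → List (Equation 𝓛 (Fin 1)) → Term 𝓛 (Fin 1) → FormulaRel 𝓛 → Class 𝓛
  QVarᶠ Y μ f _⊢ₛ_ A = A ∈ Y × (∀ Γ φ → Γ ⊢ₛ φ → Satisfiesᶠ μ f A Γ φ)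

  QVarᶠIsDualIsomorphism : FormulaRel 𝓛 → Class 𝓛 → List (Equation 𝓛 (Fin 1)) → Term 𝓛 (Fin 1) →
                           Set (lsuc (lsuc ℓ))
  QVarᶠIsDualIsomorphism _⊢_ Y μ f =
    Σ[ QVarᶠ∈Ξᶠ ∈ (∀ s → InΛᶠ _⊢_ f s → InΞᶠ Y f (QVarᶠ Y μ f s)) ]
    IsOrderIsomorphism (Poset._≈_ (Λᶠ _⊢_ f)) (Poset._≈_ (Ξᶠ Y f))
                       (Poset._≤_ (Λᶠ _⊢_ f)) (Poset._≥_ (Ξᶠ Y f))
                       (λ (s , s∈Λᶠ) → QVarᶠ Y μ f s , QVarᶠ∈Ξᶠ s s∈Λᶠ)

{-# OPTIONS --safe #-}
module Submission where

-- Write D(A) for the set of solutions in A of the equations μ(x), so that A,v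
-- satisfies μ[Γ] iff the formulas in Γ have values in D(A).  A quasivariety K
-- within Y has a logic, given by validity of rules with respect to D
-- (logicOf), and an extension ⊩ of the given logic has a quasivariety
-- (models).  The theorem relativizes the duality between these to the fixed
-- points of f, and rests on the following facts.
--
-- Every quasivariety is determined by its quasi-equations (maltsev): an
-- algebra A that satisfies those of K is separated by homomorphisms into
-- members of K, which exist for each finite part of the diagram of A and pass
-- to the whole diagram by a reduced product (compactness).  The same reduced
-- product shows that the logic of K is finitary (logicOf-finitary).
--
-- Consequently K is the class of models of its own logic (models-logicOf),
-- since Δ translates quasi-equations into rules.  Conversely each extension ⊩
-- of the given logic is complete for its models (Lindenbaum.completeness): the
-- Lindenbaum algebra of a theory satisfies the quasi-equations of Y, hence
-- lies in Y, and its designated elements are the theorems.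
--
-- For the f-logic s of ⊩, QVarᶠ s is the class of core superalgebras of models
-- of ⊩ (QVarᶠ≐↑models).  Rules are tested only at fixed points of f, where the
-- substitution of f(q) for q changes nothing, so that models of ⊩ and their
-- core superalgebras belong to QVarᶠ s.  Conversely, if A belongs to QVarᶠ s,
-- then the subalgebra generated by its fixed points is a model of ⊩, because
-- an assignment into it is a substitution followed by an assignment of fixed
-- points.  This gives values in Ξᶠ and, with K as the models of its logic,
-- surjectivity.  Completeness gives that QVarᶠ reflects the order
-- (QVarᶠ-cancel): as f is idempotent in Y, each p ↦ f(v(p)) is an assignment
-- of fixed points.
--
-- Infima in Λᶠ are the f-logics of finitary parts of intersections
-- (Λᶠ-infimum).  So Λᶠ is a complete lattice, and Ξᶠ is one by the dual
-- isomorphism.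

open import Level using (Level; _⊔_; Lift; lift) renaming (suc to lsuc)
open import Axiom.ExcludedMiddle using (ExcludedMiddle)
open import Data.Fin.Base using (Fin; zero; suc)
open import Data.List.Base using (List; []; _∷_; _++_; map; concatMap)
open import Data.List.Membership.Propositional using () renaming (_∈_ to _∈ˡ_)
open import Data.List.Membership.Propositional.Properties
  using (∈-++⁺ˡ; ∈-++⁺ʳ; ∈-map⁺; ∈-map⁻; ∈-concatMap⁺)
import Data.List.Relation.Binary.Subset.Propositional as Subset
open import Data.List.Relation.Unary.All as All using (All; []; _∷_)
import Data.List.Relation.Unary.All.Properties as All
open import Data.List.Relation.Unary.Any as Any using (here; there)
open import Data.Nat.Base using (ℕ; zero; suc)
open import Data.Product.Base using (Σ-syntax; ∃; ∃-syntax; _×_; _,_; proj₁; proj₂)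
open import Data.Vec.Base using (Vec; []; _∷_; lookup; tabulate)
open import Data.Vec.Functional using (Vector)
open import Function.Base using (id; _∘_)
open import Function.Bundles using (_⇔_; mk⇔; Equivalence)
open import Function.Properties.Equivalence using () renaming (trans to ⇔-trans)
open import Relation.Binary.Bundles using (Setoid; Poset)
open import Relation.Binary.Morphism.Structures using (IsOrderIsomorphism)
open import Relation.Binary.PropositionalEquality.Core
  using (_≡_; refl; sym; trans; cong; cong₂; subst; subst₂)
import Relation.Binary.Reasoning.Setoid as ≈-Reasoning
open import Relation.Nullary.Decidable.Core using (yes; no; True; toWitness; fromWitness; decidable-stable)
open import Relation.Nullary.Negation.Core using (¬_; contradiction)
open import Relation.Unary using (Pred; _∈_; _⊆_; _≐_)
open import Defs

open Algebra using (Carrier)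
open Equivalence using (to; from)

-- Complete lattices and dual isomorphisms

module _ {c ℓ₁ ℓ₂} (P : Poset (c ⊔ ℓ₂) ℓ₁ ℓ₂) where
  open Poset P using () renaming (Carrier to X; _≤_ to _≼_)

  infima⇒completeLattice : ((S : Pred X (c ⊔ ℓ₂)) → ∃ (IsInfimum P S)) → IsCompleteLattice P
  infima⇒completeLattice inf S = supremum , inf S
    where
    UpperBound : Pred X (c ⊔ ℓ₂)
    UpperBound u = ∀ x → x ∈ S → x ≼ u

    supremum : ∃ (IsSupremum P S)
    supremum with inf UpperBound
    ... | s , lower , greatest = s , (λ x x∈S → greatest x λ u u-upper → u-upper x x∈S) , lower

module _ {c ℓ₁ ℓ₂} (P Q : Poset (c ⊔ ℓ₁ ⊔ ℓ₂) ℓ₁ ℓ₂) where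
  private
    module P = Poset P
    module Q = Poset Q

  dualIsomorphism⇒completeLattice :
    {h : P.Carrier → Q.Carrier} → IsOrderIsomorphism P._≈_ Q._≈_ P._≤_ Q._≥_ h →
    IsCompleteLattice P → IsCompleteLattice Q
  dualIsomorphism⇒completeLattice {h} iso complete =
    infima⇒completeLattice {c ⊔ ℓ₁ ⊔ ℓ₂} Q infimum
    where
    open IsOrderIsomorphism iso

    -- The image under h of the supremum of the preimage of S.  As S need not
    -- respect equality, the preimage consists of the p with h p equal to
    -- some element of S.
    infimum : (S : Pred Q.Carrier _) → ∃ (IsInfimum Q S)
    infimum S with proj₁ (complete λ p → ∃[ y ] y ∈ S × h p Q.≈ y)
    ... | m , upper , least = h m , below , greatest
      where
      below : ∀ y → y ∈ S → h m Q.≤ y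
      below y y∈S with surjective y
      ... | p , hp≈y = Q.trans (mono (upper p (y , y∈S , hp≈y P.Eq.refl))) (Q.reflexive (hp≈y P.Eq.refl))

      greatest : ∀ l → (∀ y → y ∈ S → l Q.≤ y) → l Q.≤ h m
      greatest l l-lower with surjective l
      ... | q , hq≈l = Q.trans (Q.reflexive (Q.Eq.sym (hq≈l P.Eq.refl)))
        (mono (least q λ { p (y , y∈S , hp≈y) → cancel
          (Q.trans (Q.reflexive (hq≈l P.Eq.refl)) (Q.trans (l-lower y y∈S) (Q.reflexive (Q.Eq.sym hp≈y)))) }))

-- Finite unions of finite lists

module _ {a b p r} {A : Set a} {B : Set b} {P : Pred B p} (R : List B → A → Set r)
         (mono : ∀ {V W x} → V Subset.⊆ W → R V x → R W x) where

  -- If each member of xs is related to some finite part of P, then a single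
  -- finite part of P serves for all members of xs.
  collect : ∀ xs → (∀ {x} → x ∈ˡ xs → ∃[ V ] All P V × R V x) →
            ∃[ V ] All P V × (∀ {x} → x ∈ˡ xs → R V x)
  collect []       h = [] , [] , λ ()
  collect (x ∷ xs) h with h (here refl) | collect xs (h ∘ there)
  ... | V , V⊆P , r | W , W⊆P , s = V ++ W , All.++⁺ V⊆P W⊆P ,
    λ { (here refl) → mono ∈-++⁺ˡ r ; (there x∈) → mono (∈-++⁺ʳ V) (s x∈) }

-- Evaluation of terms, homomorphisms and embeddings

module _ {ℓ} {𝓛 : Language ℓ} where

  infix 4 _∋_≈_

  -- Equality of elements of A.
  _∋_≈_ : (A : Algebra 𝓛) → Carrier A → Carrier A → Set ℓ
  A ∋ a ≈ b = Algebra._≈_ A a b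

  mutual
    -- The variables that occur in a term, with repetitions.
    vars : ∀ {x} {X : Set x} → Term 𝓛 X → List X
    vars (var x)   = x ∷ []
    vars (op o ts) = vars* ts

    vars* : ∀ {x n} {X : Set x} → Vec (Term 𝓛 X) n → List X
    vars* []       = []
    vars* (t ∷ ts) = vars t ++ vars* ts

  mutual
    eval-agree : ∀ (A : Algebra 𝓛) {x} {X : Set x} {v w : X → Carrier A} t →
                 (∀ {y} → y ∈ˡ vars t → A ∋ v y ≈ w y) → A ∋ eval A v t ≈ eval A w t
    eval-agree A (var x)   h = h (here refl)
    eval-agree A (op o ts) h = Algebra.⟦⟧-cong A o (evals-agree A ts h)

    evals-agree : ∀ (A : Algebra 𝓛) {x n} {X : Set x} {v w : X → Carrier A} (ts : Vec (Term 𝓛 X) n) →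
                  (∀ {y} → y ∈ˡ vars* ts → A ∋ v y ≈ w y) → ∀ j → A ∋ evals A v ts j ≈ evals A w ts j
    evals-agree A (t ∷ ts) h zero    = eval-agree A t (h ∘ ∈-++⁺ˡ)
    evals-agree A (t ∷ ts) h (suc j) = evals-agree A ts (h ∘ ∈-++⁺ʳ (vars t)) j

  mutual
    eval-[] : ∀ (A : Algebra 𝓛) {x y} {X : Set x} {Y : Set y} (v : Y → Carrier A) (σ : X → Term 𝓛 Y) t →
              A ∋ eval A v (t [ σ ]) ≈ eval A (eval A v ∘ σ) t
    eval-[] A v σ (var x)   = Setoid.refl (Algebra.setoid A)
    eval-[] A v σ (op o ts) = Algebra.⟦⟧-cong A o (evals-[] A v σ ts)

    evals-[] : ∀ (A : Algebra 𝓛) {x y n} {X : Set x} {Y : Set y} (v : Y → Carrier A) (σ : X → Term 𝓛 Y)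
               (ts : Vec (Term 𝓛 X) n) → ∀ j → A ∋ evals A v (ts [ σ ]*) j ≈ evals A (eval A v ∘ σ) ts j
    evals-[] A v σ (t ∷ ts) zero    = eval-[] A v σ t
    evals-[] A v σ (t ∷ ts) (suc j) = evals-[] A v σ ts j

  -- Preservation of the operations.  Preservation of equality is not required:
  -- the projections of a reduced product need not have it.
  IsHomo : (A B : Algebra 𝓛) → (Carrier A → Carrier B) → Set ℓ
  IsHomo A B h = ∀ o as → B ∋ h (Algebra.⟦_⟧ A o as) ≈ Algebra.⟦_⟧ B o (h ∘ as)

  module _ (A B : Algebra 𝓛) (h : Carrier A → Carrier B) (homo : IsHomo A B h) where
    mutual
      eval-homo : ∀ {x} {X : Set x} (v : X → Carrier A) t → B ∋ h (eval A v t) ≈ eval B (h ∘ v) t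
      eval-homo v (var x)   = Setoid.refl (Algebra.setoid B)
      eval-homo v (op o ts) =
        Setoid.trans (Algebra.setoid B) (homo o _) (Algebra.⟦⟧-cong B o (evals-homo v ts))

      evals-homo : ∀ {x n} {X : Set x} (v : X → Carrier A) (ts : Vec (Term 𝓛 X) n) j →
                   B ∋ h (evals A v ts j) ≈ evals B (h ∘ v) ts j
      evals-homo v (t ∷ ts) zero    = eval-homo v t
      evals-homo v (t ∷ ts) (suc j) = evals-homo v ts j

  evals-tabulate : ∀ (A : Algebra 𝓛) {x n} {X : Set x} (v : X → Carrier A) (ts : Vector (Term 𝓛 X) n) j →
                   evals A v (tabulate ts) j ≡ eval A v (ts j)
  evals-tabulate A v ts zero    = refl
  evals-tabulate A v ts (suc j) = evals-tabulate A v (ts ∘ suc) j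

  mutual
    [var]-id : ∀ {x} {X : Set x} (t : Term 𝓛 X) → t [ var ] ≡ t
    [var]-id (var x)   = refl
    [var]-id (op o ts) = cong (op o) ([var]*-id ts)

    [var]*-id : ∀ {x n} {X : Set x} (ts : Vec (Term 𝓛 X) n) → ts [ var ]* ≡ ts
    [var]*-id []       = refl
    [var]*-id (t ∷ ts) = cong₂ _∷_ ([var]-id t) ([var]*-id ts)

  varsᵉ : ∀ {x} {X : Set x} → Equation 𝓛 X → List X
  varsᵉ (γ ≈̇ δ) = vars γ ++ vars δ

  module _ (A : Algebra 𝓛) where
    open Setoid (Algebra.setoid A) using () renaming (sym to ≈-sym; trans to ≈-trans)

    ⊨-transport : ∀ {x y} {X : Set x} {Y : Set y} {v : X → Carrier A} {w : Y → Carrier A}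
                  (e : Equation 𝓛 X) (e′ : Equation 𝓛 Y) →
                  A ∋ eval A v (Equation.lhs e) ≈ eval A w (Equation.lhs e′) →
                  A ∋ eval A v (Equation.rhs e) ≈ eval A w (Equation.rhs e′) →
                  A ⊨⟨ v ⟩ e ⇔ A ⊨⟨ w ⟩ e′
    ⊨-transport e e′ l r = mk⇔ (λ h → ≈-trans (≈-sym l) (≈-trans h r))
                               (λ h → ≈-trans l (≈-trans h (≈-sym r)))

    ⊨-agree : ∀ {x} {X : Set x} {v w : X → Carrier A} e →
              (∀ {y} → y ∈ˡ varsᵉ e → A ∋ v y ≈ w y) → A ⊨⟨ v ⟩ e ⇔ A ⊨⟨ w ⟩ e
    ⊨-agree e@(γ ≈̇ δ) h =
      ⊨-transport e e (eval-agree A γ (h ∘ ∈-++⁺ˡ)) (eval-agree A δ (h ∘ ∈-++⁺ʳ (vars γ)))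

    ⊨-[] : ∀ {x y} {X : Set x} {Y : Set y} (v : Y → Carrier A) (σ : X → Term 𝓛 Y) e →
           A ⊨⟨ v ⟩ e [ σ ]ᵉ ⇔ A ⊨⟨ eval A v ∘ σ ⟩ e
    ⊨-[] v σ e@(γ ≈̇ δ) = ⊨-transport (e [ σ ]ᵉ) e (eval-[] A v σ γ) (eval-[] A v σ δ)

  -- An isomorphism onto a subalgebra: a homomorphism that preserves and
  -- reflects equality.
  record _↪_ (A B : Algebra 𝓛) : Set ℓ where
    field
      fun    : Carrier A → Carrier B
      homo   : IsHomo A B fun
      embeds : ∀ {a b} → A ∋ a ≈ b ⇔ B ∋ fun a ≈ fun b

    ⊨-embed : ∀ {x} {X : Set x} (v : X → Carrier A) e → A ⊨⟨ v ⟩ e ⇔ B ⊨⟨ fun ∘ v ⟩ e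
    ⊨-embed v (γ ≈̇ δ) = ⇔-trans embeds (mk⇔
      (λ h → ≈-trans (≈-sym (eval-homo A B fun homo v γ)) (≈-trans h (eval-homo A B fun homo v δ)))
      (λ h → ≈-trans (eval-homo A B fun homo v γ) (≈-trans h (≈-sym (eval-homo A B fun homo v δ)))))
      where open Setoid (Algebra.setoid B) using () renaming (sym to ≈-sym; trans to ≈-trans)

  ≅⇒↪ : ∀ {A B} → A ≅ B → B ↪ A
  ≅⇒↪ {A} {B} iso = record
    { fun    = λ b → proj₁ (proj₂ bijective b)
    ; homo   = λ o bs → injective (B.trans (section _)
                 (B.sym (B.trans (homo o _) (Algebra.⟦⟧-cong B o λ j → section (bs j)))))
    ; embeds = mk⇔ (λ b≈c → injective (B.trans (section _) (B.trans b≈c (B.sym (section _)))))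
                   (λ a≈d → B.trans (B.sym (section _)) (B.trans (iso-cong a≈d) (section _)))
    }
    where
    module B = Setoid (Algebra.setoid B)
    open _≅_ iso using (bijective; homo) renaming (to to h; cong to iso-cong)
    injective = proj₁ bijective
    section : ∀ b → B ∋ h (proj₁ (proj₂ bijective b)) ≈ b
    section b = proj₂ (proj₂ bijective b) (Setoid.refl (Algebra.setoid A))

  subalgebra-↪ : ∀ {A} (B : Subalgebra A) → Subalgebra.algebra B ↪ A
  subalgebra-↪ {A} B = record
    { fun = proj₁ ; homo = λ o as → Setoid.refl (Algebra.setoid A) ; embeds = mk⇔ id id }

  module _ {I : Set ℓ} {𝓕 : Pred (Pred I ℓ) ℓ} (isFilter : IsFilter {𝓛 = 𝓛} 𝓕) where
    open IsFilter isFilter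

    -- A filter is closed under intersections indexed by the members of a list.
    ∈-closed : ∀ {E : Set ℓ} {P : E → Pred I ℓ} xs → (∀ x → x ∈ˡ xs → P x ∈ 𝓕) →
               (λ i → ∀ x → x ∈ˡ xs → i ∈ P x) ∈ 𝓕
    ∈-closed []       h = upward (λ _ _ ()) full
    ∈-closed (x ∷ xs) h = upward (λ { (p , ps) _ (here refl) → p ; (p , ps) y (there y∈) → ps y y∈ })
                                 (∩-closed (h x (here refl)) (∈-closed xs (λ y → h y ∘ there)))

    module _ (A : I → Algebra 𝓛) where

      eval-product : ∀ {x} {X : Set x} (v : X → Carrier (reducedProduct isFilter A)) t i →
                     A i ∋ eval (reducedProduct isFilter A) v t i ≈ eval (A i) (λ y → v y i) t
      eval-product v t i = eval-homo (reducedProduct isFilter A) (A i) (λ a → a i)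
                             (λ o as → Setoid.refl (Algebra.setoid (A i))) v t

      -- As equations are atomic, this holds for arbitrary filters.
      ⊨-product : ∀ {x} {X : Set x} (v : X → Carrier (reducedProduct isFilter A)) e →
                  reducedProduct isFilter A ⊨⟨ v ⟩ e ⇔ (λ i → A i ⊨⟨ (λ y → v y i) ⟩ e) ∈ 𝓕
      ⊨-product v (γ ≈̇ δ) = mk⇔
        (upward λ {i} h → Eq.trans i (Eq.sym i (eval-product v γ i)) (Eq.trans i h (eval-product v δ i)))
        (upward λ {i} h → Eq.trans i (eval-product v γ i) (Eq.trans i h (Eq.sym i (eval-product v δ i))))
        where module Eq i = Setoid (Algebra.setoid (A i))

-- Classical choice of truth values and of names for variables

module _ (em : ∀ {a} → ExcludedMiddle a) where

  dne : ∀ {a} {P : Set a} → ¬ ¬ P → P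
  dne = decidable-stable em

  -- A proposition equivalent to P in any given universe: by excluded middle P
  -- is decided, and the truth value of the decision is small.
  Resize : ∀ {a} b → Set a → Set b
  Resize b P = Lift b (True (em {P = P}))

  resize : ∀ {a b} {P : Set a} → P → Resize b P
  resize p = lift (fromWitness p)

  unresize : ∀ {a b} {P : Set a} → Resize b P → P
  unresize (lift p) = toWitness p

  -- A finite list of elements of X is coded by natural numbers: index gives
  -- the first position of an element in the list, and nth decodes positions.
  -- Their values outside the list do not matter.
  module _ {x} {X : Set x} (default : X) where

    index : List X → X → ℕ
    index []       x = 0
    index (y ∷ ys) x with em {P = x ≡ y}
    ... | yes _ = 0
    ... | no  _ = suc (index ys x)

    nth : List X → ℕ → X
    nth []       _       = default
    nth (y ∷ ys) zero    = y
    nth (y ∷ ys) (suc n) = nth ys n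

    nth-index : ∀ {xs x} → x ∈ˡ xs → nth xs (index xs x) ≡ x
    nth-index {y ∷ ys} {x} x∈ with em {P = x ≡ y}
    ... | yes x≡y = sym x≡y
    nth-index {y ∷ ys} (here x≡y)  | no x≢y = contradiction x≡y x≢y
    nth-index {y ∷ ys} (there x∈ys) | no x≢y = nth-index x∈ys

  module _ {ℓ} {𝓛 : Language ℓ} where

    -- Compactness, and axiomatization of quasivarieties by quasi-equations

    -- A member of K with an assignment that satisfies the premises Θ but not e.
    -- The premises are given as a family of equations, so that their index type
    -- is small whatever the universe of the variables.
    record Countermodel (K : Class 𝓛) {x} {X : Set x} {E : Set ℓ} (eqn : E → Equation 𝓛 X)
                        (Θ : Pred E ℓ) (e : Equation 𝓛 X) : Set (lsuc ℓ ⊔ x) where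
      field
        model     : Algebra 𝓛
        model∈K   : model ∈ K
        valuation : X → Carrier model
        premises  : ∀ {i} → i ∈ Θ → model ⊨⟨ valuation ⟩ eqn i
        fails     : ¬ model ⊨⟨ valuation ⟩ e

    no-countermodel : ∀ {K Θ e} → ¬ Countermodel K id Θ e → Θ ⊨[ K ] e
    no-countermodel none A A∈K v v⊨Θ = dne λ fails → none record
      { model = A ; model∈K = A∈K ; valuation = v ; premises = v⊨Θ ; fails = fails }

    module _ {K : Class 𝓛} (K-quasi : IsQuasivariety K) where
      open IsQuasivariety K-quasi

      module _ {x} {X : Set x} {E : Set ℓ} (eqn : E → Equation 𝓛 X) {Θ : Pred E ℓ} {e : Equation 𝓛 X}
               (finite : ∀ F → All Θ F → Countermodel K eqn (_∈ˡ F) e) where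
        private
          -- The finite parts F of Θ index the reduced product of their countermodels.
          -- The filter is generated by the sets of all G that extend a given F.
          Index : Set ℓ
          Index = ∃ (All Θ)

          module M (i : Index) = Countermodel (finite (proj₁ i) (proj₂ i))

          Tail : Pred (Pred Index ℓ) ℓ
          Tail P = ∃[ F ] (∀ (G : Index) → proj₁ {B = All Θ} F Subset.⊆ proj₁ G → P G)

          tail-isFilter : IsFilter {𝓛 = 𝓛} Tail
          tail-isFilter = record
            { full     = ([] , []) , λ _ _ → _
            ; ∩-closed = λ { ((F , F⊆Θ) , p) ((G , G⊆Θ) , q) →
                (F ++ G , All.++⁺ F⊆Θ G⊆Θ) ,
                λ H FG⊆H → p H (FG⊆H ∘ ∈-++⁺ˡ) , q H (FG⊆H ∘ ∈-++⁺ʳ F) }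
            ; upward   = λ P⊆Q (F , p) → F , λ G F⊆G → P⊆Q (p G F⊆G)
            }

        -- If each finite part of Θ has a countermodel in K, then so has Θ.
        compactness : Countermodel K eqn Θ e
        compactness = record
          { model     = reducedProduct tail-isFilter M.model
          ; model∈K   = product-closed tail-isFilter M.model M.model∈K
          ; valuation = λ y i → M.valuation i y
          ; premises  = λ {j} j∈Θ → from (⊨-product tail-isFilter M.model _ (eqn j))
              ((j ∷ [] , j∈Θ ∷ []) , λ G j⊆G → M.premises G (j⊆G (here refl)))
          ; fails     = λ holds → let F , h = to (⊨-product tail-isFilter M.model _ e) holds
                                  in M.fails F (h F id)
          }

      -- If no finite part of Θ entailed e, each would have a countermodel, and the
      -- reduced product of these would be a countermodel for Θ.
      ⊨-finitary : ∀ {Θ e} → Θ ⊨[ K ] e → ∃[ F ] All Θ F × (_∈ˡ F) ⊨[ K ] e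
      ⊨-finitary {Θ} {e} Θ⊨e = dne λ none →
        let cm = compactness id {Θ} {e} λ F F⊆Θ → dne λ no-cm → none (F , F⊆Θ , no-countermodel no-cm)
            open Countermodel cm
        in fails (Θ⊨e model model∈K valuation premises)

      module _ (A : Algebra 𝓛)
               (quasi-equations : ∀ F e → (_∈ˡ F) ⊨[ K ] e → ∀ v →
                                  (∀ {e′} → e′ ∈ˡ F → A ⊨⟨ v ⟩ e′) → A ⊨⟨ v ⟩ e)
               where
        private
          -- The equations between elements of A that hold in A, with the elements
          -- themselves as variables.  An assignment into B that satisfies the diagram
          -- is a homomorphism from A to B.
          Diagram : Pred (Equation 𝓛 (Carrier A)) ℓ
          Diagram = A ⊨⟨ id ⟩_

          -- A finite part F of the diagram and the equation e mention finitely many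
          -- elements of A, which are renamed to natural numbers.  If the renamed F
          -- entailed the renamed e over K, then e would hold in A.
          finite-countermodel : ∀ {e} → ¬ A ⊨⟨ id ⟩ e → ∀ F → All Diagram F → Countermodel K id (_∈ˡ F) e
          finite-countermodel {e} A⊭e F A⊨F = record
            { model     = model
            ; model∈K   = model∈K
            ; valuation = valuation ∘ ι
            ; premises  = λ {e′} e′∈F → to (⊨-[] model valuation (var ∘ ι) e′)
                                           (premises (∈-map⁺ (_[ var ∘ ι ]ᵉ) e′∈F))
            ; fails     = fails ∘ from (⊨-[] model valuation (var ∘ ι) e)
            }
            where
            names : List (Carrier A)
            names = concatMap varsᵉ (e ∷ F)

            ι : Carrier A → ℕ
            ι = index (Algebra.nonempty A) names

            v : ℕ → Carrier A
            v = nth (Algebra.nonempty A) names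

            renamed : ∀ {e′} → e′ ∈ˡ e ∷ F → A ⊨⟨ v ⟩ e′ [ var ∘ ι ]ᵉ ⇔ A ⊨⟨ id ⟩ e′
            renamed {e′} e′∈ = ⇔-trans (⊨-[] A v (var ∘ ι) e′) (⊨-agree A e′ λ y∈ →
              Setoid.reflexive (Algebra.setoid A)
                (nth-index _ (∈-concatMap⁺ varsᵉ (Any.map (λ { refl → y∈ }) e′∈))))

            countermodel : Countermodel K id (_∈ˡ map (_[ var ∘ ι ]ᵉ) F) (e [ var ∘ ι ]ᵉ)
            countermodel = dne λ none → A⊭e (to (renamed (here refl))
              (quasi-equations _ (e [ var ∘ ι ]ᵉ) (no-countermodel none) v
                λ e″∈ → renamed-F (∈-map⁻ (_[ var ∘ ι ]ᵉ) e″∈)))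
              where
              renamed-F : ∀ {e″} → (∃[ e′ ] e′ ∈ˡ F × e″ ≡ e′ [ var ∘ ι ]ᵉ) → A ⊨⟨ v ⟩ e″
              renamed-F (e′ , e′∈F , refl) = from (renamed (there e′∈F)) (All.lookup A⊨F e′∈F)

            open Countermodel countermodel

          -- For each pair of distinct elements of A, compactness yields a homomorphism
          -- into a member of K that separates the pair.  Excluded middle for arbitrary
          -- types chooses all of these at once.
          Distinct : Set ℓ
          Distinct = Σ[ ab ∈ Carrier A × Carrier A ] ¬ A ∋ proj₁ ab ≈ proj₂ ab

          module S (i : Distinct) = Countermodel
            (compactness id {Diagram} {var (proj₁ (proj₁ i)) ≈̇ var (proj₂ (proj₁ i))}
               (finite-countermodel (proj₂ i)))

          separate-homo : ∀ i → IsHomo A (S.model i) (S.valuation i)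
          separate-homo i o as = Eq.sym (Eq.trans
            (Algebra.⟦⟧-cong (S.model i) o λ j → Eq.sym (Eq.reflexive (evals-tabulate (S.model i) _ (var ∘ as) j)))
            (S.premises i {op o (tabulate (var ∘ as)) ≈̇ var (Algebra.⟦_⟧ A o as)}
              (Algebra.⟦⟧-cong A o λ j → Setoid.reflexive (Algebra.setoid A) (evals-tabulate A id (var ∘ as) j))))
            where module Eq = Setoid (Algebra.setoid (S.model i))

          -- The least filter, whose reduced product is the direct product.
          Everywhere : Pred (Pred Distinct ℓ) ℓ
          Everywhere P = ∀ i → P i

          everywhere-isFilter : IsFilter {𝓛 = 𝓛} Everywhere
          everywhere-isFilter = record
            { full = λ _ → _ ; ∩-closed = λ p q i → p i , q i ; upward = λ P⊆Q p i → P⊆Q (p i) }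

          Product : Algebra 𝓛
          Product = reducedProduct everywhere-isFilter S.model

          diagonal : Carrier A → Carrier Product
          diagonal a i = S.valuation i a

          diagonal-cong : ∀ {a b} → A ∋ a ≈ b → Product ∋ diagonal a ≈ diagonal b
          diagonal-cong {a} {b} a≈b i = S.premises i {var a ≈̇ var b} a≈b

          diagonal-injective : ∀ {a b} → Product ∋ diagonal a ≈ diagonal b → A ∋ a ≈ b
          diagonal-injective {a} {b} eq = dne λ a≉b → S.fails ((a , b) , a≉b) (eq ((a , b) , a≉b))

          module Product = Setoid (Algebra.setoid Product)

          range : Subalgebra Product
          range = record
            { Universe = λ p → ∃[ a ] Product ∋ diagonal a ≈ p
            ; resp     = λ p≈q (a , a≈p) → a , Product.trans a≈p p≈q
            ; closed   = λ o ps h → Algebra.⟦_⟧ A o (proj₁ ∘ h) ,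
                Product.trans (λ i → separate-homo i o (proj₁ ∘ h))
                              (Algebra.⟦⟧-cong Product o (proj₂ ∘ h))
            ; nonempty = diagonal (Algebra.nonempty A) , Algebra.nonempty A , Product.refl
            }

          range≅A : Subalgebra.algebra range ≅ A
          range≅A = record
            { to        = λ (_ , a , _) → a
            ; homo      = λ o ps → Setoid.refl (Algebra.setoid A)
            ; cong      = λ { {_ , a , a≈p} {_ , b , b≈q} p≈q → diagonal-injective
                              (Product.trans a≈p (Product.trans p≈q (Product.sym b≈q))) }
            ; bijective = (λ { {_ , a , a≈p} {_ , b , b≈q} a≈b →
                              Product.trans (Product.sym a≈p) (Product.trans (diagonal-cong a≈b) b≈q) })
                        , (λ a → (diagonal a , a , Product.refl) ,
                              λ { {_ , b , b≈q} q≈a → diagonal-injective (Product.trans b≈q q≈a) })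
            }

        -- An algebra that satisfies the quasi-equations of a quasivariety K belongs
        -- to K, being isomorphic to a subalgebra of a product of members of K.
        maltsev : A ∈ K
        maltsev = iso-closed range≅A (sub-closed (product-closed everywhere-isFilter S.model S.model∈K) range)

  -- Logics and their algebraic models

  module _ {ℓ} {𝓛 : Language ℓ} (μ : List (Equation 𝓛 (Fin 1))) where

    -- The designated elements of A: the solutions of the equations μ(x).
    Designated : (A : Algebra 𝓛) → Pred (Carrier A) ℓ
    Designated A a = ∀ m → m ∈ˡ μ → A ⊨⟨ (λ _ → a) ⟩ m

    designated-cong : ∀ A {a b} → A ∋ a ≈ b → Designated A a → Designated A b
    designated-cong A a≈b d m m∈μ = to (⊨-agree A m λ _ → a≈b) (d m m∈μ)

    designated-⟨⟩ : ∀ A (v : ℕ → Carrier A) φ → (∀ {e} → e ∈ μ ⟨ φ ⟩ᴱ → A ⊨⟨ v ⟩ e) ⇔ Designated A (eval A v φ)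
    designated-⟨⟩ A v φ = mk⇔ holds⇒designated designated⇒holds
      where
      holds⇒designated : (∀ {e} → e ∈ μ ⟨ φ ⟩ᴱ → A ⊨⟨ v ⟩ e) → Designated A (eval A v φ)
      holds⇒designated h m m∈μ = to (⊨-[] A v (λ _ → φ) m) (h (∈-map⁺ (_[ (λ _ → φ) ]ᵉ) m∈μ))

      designated⇒holds : Designated A (eval A v φ) → ∀ {e} → e ∈ μ ⟨ φ ⟩ᴱ → A ⊨⟨ v ⟩ e
      designated⇒holds d e∈ with ∈-map⁻ (_[ (λ _ → φ) ]ᵉ) e∈
      ... | m , m∈μ , refl = from (⊨-[] A v (λ _ → φ) m) (d m m∈μ)

    -- A, v ⊨ μ[Γ].
    AllDesignated : (A : Algebra 𝓛) → (ℕ → Carrier A) → Pred (Formula 𝓛) ℓ → Set ℓ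
    AllDesignated A v Γ = ∀ {ψ} → ψ ∈ Γ → Designated A (eval A v ψ)

    designated-[] : ∀ A (v : ℕ → Carrier A) Γ → (∀ {e} → e ∈ μ [ Γ ]ᴱ → A ⊨⟨ v ⟩ e) ⇔ AllDesignated A v Γ
    designated-[] A v Γ = mk⇔
      (λ h {ψ} ψ∈Γ → to (designated-⟨⟩ A v ψ) λ {e} e∈ → h {e} (ψ , ψ∈Γ , e∈))
      (λ d → λ { (ψ , ψ∈Γ , e∈) → from (designated-⟨⟩ A v ψ) (d ψ∈Γ) e∈ })

    designated-subst : ∀ A (v : ℕ → Carrier A) (σ : ℕ → Formula 𝓛) (φ : Formula 𝓛) →
                       Designated A (eval A v (φ [ σ ])) ⇔ Designated A (eval A (eval A v ∘ σ) φ)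
    designated-subst A v σ φ = mk⇔ (designated-cong A (eval-[] A v σ φ))
      (designated-cong A (Setoid.sym (Algebra.setoid A) (eval-[] A v σ φ)))

    -- A validates the rule Γ / φ: in A, μ[Γ] implies μ(φ) under all assignments.
    Validates : Algebra 𝓛 → Pred (Formula 𝓛) ℓ → Formula 𝓛 → Set ℓ
    Validates A Γ φ = ∀ v → AllDesignated A v Γ → Designated A (eval A v φ)

    -- The consequence relation of a class of algebras, with premises and
    -- conclusion read as membership in the designated elements.
    logicOf : Class 𝓛 → FormulaRel 𝓛
    logicOf K Γ φ = ∀ A → A ∈ K → Validates A Γ φ

    -- The members of Y that validate all rules of a consequence relation.
    models : Class 𝓛 → FormulaRel 𝓛 → Class 𝓛
    models Y _⊩_ A = A ∈ Y × (∀ Γ φ → Γ ⊩ φ → Validates A Γ φ)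

    designated-fun : ∀ {A B} (h : A ↪ B) a → Designated A a ⇔ Designated B (_↪_.fun h a)
    designated-fun h a = mk⇔ (λ d m m∈μ → to (_↪_.⊨-embed h (λ _ → a) m) (d m m∈μ))
                             (λ d m m∈μ → from (_↪_.⊨-embed h (λ _ → a) m) (d m m∈μ))

    designated-↪ : ∀ {A B} (h : A ↪ B) (v : ℕ → Carrier A) (φ : Formula 𝓛) →
                   Designated A (eval A v φ) ⇔ Designated B (eval B (_↪_.fun h ∘ v) φ)
    designated-↪ {A} {B} h v φ = ⇔-trans (designated-fun h (eval A v φ)) (mk⇔
      (designated-cong B preserved)
      (designated-cong B (Setoid.sym (Algebra.setoid B) preserved)))
      where preserved = eval-homo A B (_↪_.fun h) (_↪_.homo h) v φ

    validates-↪ : ∀ {A B Γ φ} → A ↪ B → Validates B Γ φ → Validates A Γ φ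
    validates-↪ {φ = φ} h valid v d =
      from (designated-↪ h v φ) (valid (_↪_.fun h ∘ v) λ {ψ} ψ∈Γ → to (designated-↪ h v ψ) (d ψ∈Γ))

    module _ {I : Set ℓ} {𝓕 : Pred (Pred I ℓ) ℓ} (isFilter : IsFilter {𝓛 = 𝓛} 𝓕) (A : I → Algebra 𝓛) where
      open IsFilter isFilter

      designated-product : ∀ a → Designated (reducedProduct isFilter A) a ⇔ (λ i → Designated (A i) (a i)) ∈ 𝓕
      designated-product a = mk⇔
        (λ d → ∈-closed isFilter μ λ m m∈μ → to (⊨-product isFilter A (λ _ → a) m) (d m m∈μ))
        (λ h m m∈μ → from (⊨-product isFilter A (λ _ → a) m) (upward (λ d → d m m∈μ) h))

      validates-product : ∀ V φ → (∀ i → Validates (A i) (_∈ˡ V) φ) →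
                          Validates (reducedProduct isFilter A) (_∈ˡ V) φ
      validates-product V φ valid v d = from (designated-product _) (upward
        (λ {i} ds → designated-cong (A i) (Setoid.sym (Algebra.setoid (A i)) (eval-product isFilter A v φ i))
           (valid i _ λ {ψ} ψ∈V → designated-cong (A i) (eval-product isFilter A v ψ i) (ds ψ ψ∈V)))
        (∈-closed isFilter V λ ψ ψ∈V → to (designated-product _) (d ψ∈V)))

    -- Finitarity reduces closure under reduced products to rules with finitely
    -- many premises, for which filters are closed under the required
    -- intersections.
    models-isQuasivariety : ∀ {Y _⊩_} → IsQuasivariety Y → IsConsequenceRelation _⊩_ →
                            IsQuasivariety (models Y _⊩_)
    models-isQuasivariety Y-quasi cr = record
      { iso-closed     = λ { A≅B (A∈Y , valid) →
          iso-closed A≅B A∈Y , λ Γ φ Γ⊩φ → validates-↪ {Γ = Γ} {φ} (≅⇒↪ A≅B) (valid Γ φ Γ⊩φ) }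
      ; sub-closed     = λ { (A∈Y , valid) B →
          sub-closed A∈Y B , λ Γ φ Γ⊩φ → validates-↪ {Γ = Γ} {φ} (subalgebra-↪ B) (valid Γ φ Γ⊩φ) }
      ; product-closed = λ isFilter A A∈ →
          product-closed isFilter A (proj₁ ∘ A∈) , λ Γ φ Γ⊩φ v d →
            let V , V⊆Γ , V⊩φ = finitary Γ⊩φ in
            validates-product isFilter A V φ (λ i → proj₂ (A∈ i) _ φ V⊩φ) v (λ ψ∈V → d (All.lookup V⊆Γ ψ∈V))
      }
      where
      open IsQuasivariety Y-quasi
      open IsConsequenceRelation cr using (finitary)

    module _ {K : Class 𝓛} (K-quasi : IsQuasivariety K) where

      private
        -- Entailment over K of the instance m(φ) of an equation m(x) by μ[V].
        Follows : List (Formula 𝓛) → Formula 𝓛 → Equation 𝓛 (Fin 1) → Set (lsuc ℓ)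
        Follows V φ m = (μ [ (_∈ˡ V) ]ᴱ) ⊨[ K ] m [ (λ _ → φ) ]ᵉ

        weaken : ∀ {V W e} → V Subset.⊆ W → e ∈ μ [ (_∈ˡ V) ]ᴱ → e ∈ μ [ (_∈ˡ W) ]ᴱ
        weaken V⊆W (ψ , ψ∈V , e∈) = ψ , V⊆W ψ∈V , e∈

        follows-mono : ∀ φ {V W m} → V Subset.⊆ W → Follows V φ m → Follows W φ m
        follows-mono φ V⊆W h A A∈K v d = h A A∈K v λ {e} e∈ → d {e} (weaken {e = e} V⊆W e∈)

        finite-sources : ∀ {Γ} F → All (_∈ μ [ Γ ]ᴱ) F →
                         ∃[ V ] All (_∈ Γ) V × (∀ {e} → e ∈ˡ F → e ∈ μ [ (_∈ˡ V) ]ᴱ)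
        finite-sources {Γ} F F⊆μΓ = collect {P = Γ} (λ V e → e ∈ μ [ (_∈ˡ V) ]ᴱ) (λ {_} {_} {e} → weaken {e = e}) F
          λ e∈F → let ψ , ψ∈Γ , e∈ = All.lookup F⊆μΓ e∈F
                  in ψ ∷ [] , ψ∈Γ ∷ [] , ψ , here refl , e∈

        finitely-follows : ∀ {Γ φ m} → (μ [ Γ ]ᴱ) ⊨[ K ] m [ (λ _ → φ) ]ᵉ →
                           ∃[ V ] All (_∈ Γ) V × Follows V φ m
        finitely-follows {Γ} {φ} {m} Γ⊨m =
          let F , F⊆μΓ , F⊨m = ⊨-finitary K-quasi {μ [ Γ ]ᴱ} {m [ (λ _ → φ) ]ᵉ} Γ⊨m
              V , V⊆Γ , F⊆μV = finite-sources F F⊆μΓ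
          in V , V⊆Γ , λ A A∈K v d → F⊨m A A∈K v λ e∈F → d (F⊆μV e∈F)

      -- Each of the finitely many equations of μ(φ) follows from finitely many
      -- equations of μ[Γ], which come from finitely many formulas of Γ.
      logicOf-finitary : ∀ {Γ φ} → logicOf K Γ φ → ∃[ V ] All (_∈ Γ) V × logicOf K (_∈ˡ V) φ
      logicOf-finitary {Γ} {φ} Γ⊢φ = proj₁ support , proj₁ (proj₂ support) , λ A A∈K v d m m∈μ →
        to (⊨-[] A v (λ _ → φ) m)
           (proj₂ (proj₂ support) m∈μ A A∈K v (from (designated-[] A v (_∈ˡ proj₁ support)) d))
        where
        follows : ∀ {m} → m ∈ˡ μ → (μ [ Γ ]ᴱ) ⊨[ K ] m [ (λ _ → φ) ]ᵉ
        follows {m} m∈μ A A∈K v d = from (designated-⟨⟩ A v φ)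
          (Γ⊢φ A A∈K v (to (designated-[] A v Γ) d)) (∈-map⁺ (_[ (λ _ → φ) ]ᵉ) m∈μ)

        support : ∃[ V ] All (_∈ Γ) V × (∀ {m} → m ∈ˡ μ → Follows V φ m)
        support = collect {P = Γ} (λ V → Follows V φ) (λ {_} {_} {m} → follows-mono φ {m = m}) μ
          λ {m} m∈μ → finitely-follows {m = m} (follows m∈μ)

      logicOf-isLogic : IsLogic (logicOf K)
      logicOf-isLogic = record
        { isConsequenceRelation = record
          { reflexive = λ φ∈Γ A A∈K v d → d φ∈Γ
          ; cut       = λ Γ⊢V V⊢φ A A∈K v d → V⊢φ A A∈K v λ ψ∈V → Γ⊢V ψ∈V A A∈K v d
          ; finitary  = λ {Γ} {φ} → logicOf-finitary {Γ} {φ}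
          }
        ; substitution-invariant = λ {Γ} {φ} σ Γ⊢φ A A∈K v d → from (designated-subst A v σ φ)
            (Γ⊢φ A A∈K _ λ {ψ} ψ∈Γ → to (designated-subst A v σ ψ) (d (ψ , ψ∈Γ , refl)))
        }

    -- Algebraizable logics and Lindenbaum algebras

    module Algebraizable {_⊢_ : FormulaRel 𝓛} {Y : Class 𝓛} {Δ : List (Term 𝓛 (Fin 2))}
                         (Y-quasi : IsQuasivariety Y) (alg : IsAlgebraizable _⊢_ Y μ Δ) where
      open IsAlgebraizable alg

      ⊢⇒logicOf : ∀ {Γ φ} → Γ ⊢ φ → logicOf Y Γ φ
      ⊢⇒logicOf {Γ} {φ} Γ⊢φ A A∈Y v d = to (designated-⟨⟩ A v φ) λ e∈ →
        to (⊢⇔⊨ Γ φ) Γ⊢φ e∈ A A∈Y v (from (designated-[] A v Γ) d)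

      -- In members of Y, the equation e says that the formulas Δ(e) are designated.
      ⊨⇔Δ-designated : ∀ {A} → A ∈ Y → ∀ v e → A ⊨⟨ v ⟩ e ⇔ AllDesignated A v (Δ ⟨ e ⟩ᵀ)
      ⊨⇔Δ-designated {A} A∈Y v e = mk⇔
        (λ h {χ} χ∈ → to (designated-⟨⟩ A v χ) λ e′∈ →
           proj₁ (⊨μΔ e) (χ , χ∈ , e′∈) A A∈Y v λ { refl → h })
        (λ d → proj₂ (⊨μΔ e) A A∈Y v λ { (χ , χ∈ , e′∈) → from (designated-⟨⟩ A v χ) (d χ∈) e′∈ })

      -- With ⊨⇔Δ-designated a quasi-equation of K becomes a set of rules of the
      -- logic of K, so models of this logic satisfy the quasi-equations of K.
      models-logicOf : ∀ {K} → IsQuasivariety K → K ⊆ Y → models Y (logicOf K) ⊆ K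
      models-logicOf K-quasi K⊆Y {A} (A∈Y , valid) = maltsev K-quasi A λ F e F⊨e v A⊨F →
        from (⊨⇔Δ-designated A∈Y v e) λ {χ} χ∈ →
          valid (Δ [ (_∈ˡ F) ]ᵀ) χ
            (λ B B∈K w d → to (⊨⇔Δ-designated (K⊆Y B∈K) w e)
               (F⊨e B B∈K w λ {e′} e′∈F → from (⊨⇔Δ-designated (K⊆Y B∈K) w e′)
                  λ χ′∈ → d (e′ , e′∈F , χ′∈)) χ∈)
            v (λ (e′ , e′∈F , χ′∈) → to (⊨⇔Δ-designated A∈Y v e′) (A⊨F e′∈F) χ′∈)

      -- The Lindenbaum algebra of the theory of Γ under an extension of the
      -- algebraizable logic: formulas γ and δ are identified when Γ proves Δ(γ, δ).
      module Lindenbaum {_⊩_ : FormulaRel 𝓛} (logic : IsLogic _⊩_) (⊢⊆⊩ : ∀ {Γ φ} → Γ ⊢ φ → Γ ⊩ φ)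
                        (Γ : Pred (Formula 𝓛) ℓ) where
        open IsLogic logic
        open IsConsequenceRelation isConsequenceRelation

        -- The set of equations e such that Γ proves Δ(e), as a predicate in the
        -- universe of the formulas.
        Provable : Pred (Equation 𝓛 ℕ) ℓ
        Provable e = Resize ℓ (∀ χ → χ ∈ Δ ⟨ e ⟩ᵀ → Γ ⊩ χ)

        -- Closure under entailment over Y makes provable equality a congruence and
        -- puts the Lindenbaum algebra into Y.
        provable-closed : ∀ e → Provable ⊨[ Y ] e → Provable e
        provable-closed e h = resize λ χ χ∈ →
          cut (λ { (e′ , e′∈ , χ′∈) → unresize e′∈ _ χ′∈ }) (⊢⊆⊩ (to (⊨⇔⊢ Provable e) h χ∈))

        algebra : Algebra 𝓛
        algebra = record
          { setoid   = record
            { Carrier       = Formula 𝓛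
            ; _≈_           = λ γ δ → Provable (γ ≈̇ δ)
            ; isEquivalence = record
              { refl  = λ {γ} → provable-closed (γ ≈̇ γ) λ A _ v _ → Setoid.refl (Algebra.setoid A)
              ; sym   = λ {γ} {δ} p → provable-closed (δ ≈̇ γ) λ A _ v h →
                  Setoid.sym (Algebra.setoid A) (h p)
              ; trans = λ {γ} {δ} {ε} p q → provable-closed (γ ≈̇ ε) λ A _ v h →
                  Setoid.trans (Algebra.setoid A) (h p) (h q)
              }
            }
          ; ⟦_⟧      = λ o ts → op o (tabulate ts)
          ; ⟦⟧-cong  = λ o {γs} {δs} p → provable-closed (op o (tabulate γs) ≈̇ op o (tabulate δs)) λ A _ v h →
              Algebra.⟦⟧-cong A o λ j →
                subst₂ (A ∋_≈_) (sym (evals-tabulate A v γs j)) (sym (evals-tabulate A v δs j)) (h (p j))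
          ; nonempty = var 0
          }

        mutual
          eval≡[] : ∀ {x} {X : Set x} (σ : X → Formula 𝓛) t → eval algebra σ t ≡ t [ σ ]
          eval≡[] σ (var x)   = refl
          eval≡[] σ (op o ts) = cong (op o) (evals≡[]* σ ts)

          evals≡[]* : ∀ {x n} {X : Set x} (σ : X → Formula 𝓛) (ts : Vec (Term 𝓛 X) n) →
                      tabulate (evals algebra σ ts) ≡ ts [ σ ]*
          evals≡[]* σ []       = refl
          evals≡[]* σ (t ∷ ts) = cong₂ _∷_ (eval≡[] σ t) (evals≡[]* σ ts)

        ⊨≡provable : ∀ {x} {X : Set x} (σ : X → Formula 𝓛) e → (algebra ⊨⟨ σ ⟩ e) ≡ Provable (e [ σ ]ᵉ)
        ⊨≡provable σ (γ ≈̇ δ) = cong₂ (λ l r → Provable (l ≈̇ r)) (eval≡[] σ γ) (eval≡[] σ δ)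

        algebra∈Y : algebra ∈ Y
        algebra∈Y = maltsev Y-quasi algebra λ F e F⊨e σ A⊨F →
          subst id (sym (⊨≡provable σ e)) (provable-closed (e [ σ ]ᵉ) λ A A∈Y v h →
            from (⊨-[] A v σ e) (F⊨e A A∈Y _ λ {e′} e′∈F →
              to (⊨-[] A v σ e′) (h {e′ [ σ ]ᵉ} (subst id (⊨≡provable σ e′) (A⊨F e′∈F)))))

        -- This is the interderivability of φ with Δ[μ(φ)].
        designated⇔provable : ∀ φ → Designated algebra φ ⇔ Γ ⊩ φ
        designated⇔provable φ = mk⇔
          (λ d → cut (λ { (e , e∈ , χ∈) → instance-provable d (∈-map⁻ (_[ (λ _ → φ) ]ᵉ) e∈) χ∈ })
                     (⊢⊆⊩ (proj₂ (⊣⊢Δμ φ))))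
          (λ Γ⊩φ m m∈μ → subst id (sym (⊨≡provable (λ _ → φ) m)) (resize λ χ χ∈ →
             cut (λ { refl → Γ⊩φ })
                 (⊢⊆⊩ (proj₁ (⊣⊢Δμ φ) (_ , ∈-map⁺ (_[ (λ _ → φ) ]ᵉ) m∈μ , χ∈)))))
          where
          instance-provable : Designated algebra φ → ∀ {e χ} →
            (∃[ m ] m ∈ˡ μ × e ≡ m [ (λ _ → φ) ]ᵉ) → χ ∈ Δ ⟨ e ⟩ᵀ → Γ ⊩ χ
          instance-provable d (m , m∈μ , refl) χ∈ =
            unresize (subst id (⊨≡provable (λ _ → φ) m) (d m m∈μ)) _ χ∈

        designated-eval : ∀ (σ : ℕ → Formula 𝓛) (φ : Formula 𝓛) →
                          Designated algebra (eval algebra σ φ) ⇔ Γ ⊩ φ [ σ ]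
        designated-eval σ φ =
          subst (λ ψ → Designated algebra ψ ⇔ Γ ⊩ φ [ σ ]) (sym (eval≡[] σ φ)) (designated⇔provable (φ [ σ ]))

        algebra∈models : algebra ∈ models Y _⊩_
        algebra∈models = algebra∈Y , λ W φ W⊩φ σ d → from (designated-eval σ φ)
          (cut (λ { (ψ , ψ∈W , refl) → to (designated-eval σ ψ) (d ψ∈W) }) (substitution-invariant σ W⊩φ))

        completeness : ∀ {φ} → logicOf (models Y _⊩_) Γ φ → Γ ⊩ φ
        completeness {φ} valid = subst (Γ ⊩_) ([var]-id φ) (to (designated-eval var φ)
          (valid algebra algebra∈models var λ {ψ} ψ∈Γ →
            from (designated-eval var ψ) (subst (Γ ⊩_) (sym ([var]-id ψ)) (reflexive ψ∈Γ))))

  -- Infima of finitary logics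

  -- The intersection of a family of finitary logics need not be finitary.  Its
  -- finitary part relates Γ to φ when some finite part of Γ proves φ in all
  -- logics of the family.  The family may be indexed by a large type.
  module Meet {ℓ} {𝓛 : Language ℓ} {i} {I : Set i} (𝓢 : I → FormulaRel 𝓛) (logic : ∀ j → IsLogic (𝓢 j)) where
    private
      module Logic j = IsLogic (logic j)
      module Consequence j = IsConsequenceRelation (Logic.isConsequenceRelation j)

      -- V proves φ in all logics of the family.
      Common : List (Formula 𝓛) → Formula 𝓛 → Set (lsuc ℓ)
      Common V φ = Resize (lsuc ℓ) (∀ j → 𝓢 j (_∈ˡ V) φ)

      common-mono : ∀ {V W φ} → V Subset.⊆ W → Common V φ → Common W φ
      common-mono V⊆W V⊢φ = resize λ j →
        Consequence.cut j (λ ψ∈V → Consequence.reflexive j (V⊆W ψ∈V)) (unresize V⊢φ j)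

    meet : FormulaRel 𝓛
    meet Γ φ = ∃[ V ] All (_∈ Γ) V × Common V φ

    meet-isLogic : IsLogic meet
    meet-isLogic = record
      { isConsequenceRelation = record
        { reflexive = λ {_} {φ} φ∈Γ →
            φ ∷ [] , φ∈Γ ∷ [] , resize λ j → Consequence.reflexive j (here refl)
        ; cut       = λ { {Γ} Γ⊢V (V , V⊆ , V⊢φ) →
            let W , W⊆Γ , W⊢V = collect {P = Γ} Common common-mono V (λ ψ∈V → Γ⊢V (All.lookup V⊆ ψ∈V))
            in W , W⊆Γ , resize λ j → Consequence.cut j (λ ψ∈V → unresize (W⊢V ψ∈V) j) (unresize V⊢φ j) }
        ; finitary  = λ { (V , V⊆Γ , V⊢φ) → V , V⊆Γ , V , All.tabulate id , V⊢φ }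
        }
      ; substitution-invariant = λ { σ (V , V⊆Γ , V⊢φ) →
          map (_[ σ ]) V ,
          All.map⁺ (All.map (λ {ψ} ψ∈Γ → ψ , ψ∈Γ , refl) V⊆Γ) ,
          resize λ j → Consequence.cut j
            (λ { (ψ , ψ∈V , refl) → Consequence.reflexive j (∈-map⁺ (_[ σ ]) ψ∈V) })
            (Logic.substitution-invariant j σ (unresize V⊢φ j)) }
      }

    meet⇒ : ∀ {Γ φ} → meet Γ φ → ∀ j → 𝓢 j Γ φ
    meet⇒ (V , V⊆Γ , V⊢φ) j =
      Consequence.cut j (λ ψ∈V → Consequence.reflexive j (All.lookup V⊆Γ ψ∈V)) (unresize V⊢φ j)

  module Selector {ℓ} {𝓛 : Language ℓ} (f : Term 𝓛 (Fin 1)) where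

    -- The substitution that replaces each variable q by f(q).
    fσ : ℕ → Formula 𝓛
    fσ q = f ⟪ var q ⟫

    -- The operation of A that the term f defines.
    apply : (A : Algebra 𝓛) → Carrier A → Carrier A
    apply A a = eval A (λ _ → a) f

    apply-cong : ∀ A {a b} → A ∋ a ≈ b → A ∋ apply A a ≈ apply A b
    apply-cong A a≈b = eval-agree A f λ _ → a≈b

    eval-fσ : ∀ A (v : ℕ → Carrier A) φ → A ∋ eval A v (φ [ fσ ]) ≈ eval A (apply A ∘ v) φ
    eval-fσ A v φ = Setoid.trans (Algebra.setoid A) (eval-[] A v fσ φ)
      (eval-agree A φ λ {q} _ → eval-[] A v (λ _ → var q) f)

    -- The complete lattice of f-logics

    module _ {_⊢_ : FormulaRel 𝓛} (⊢-logic : IsLogic _⊢_) where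
      open Poset (Λᶠ _⊢_ f) using () renaming (Carrier to L; _≤_ to _≼_)

      Λᶠ-infimum : (S : Pred L (lsuc (lsuc ℓ))) → ∃ (IsInfimum (Λᶠ _⊢_ f) S)
      Λᶠ-infimum S = meetᶠ , below , greatest
        where
        ⊢-of : ∃ S → FormulaRel 𝓛
        ⊢-of ((_ , ⊢* , _) , _) = ⊢*

        ⊢-of-InΛ : ∀ x → InΛ _⊢_ (⊢-of x)
        ⊢-of-InΛ ((_ , _ , ⊢*∈Λ , _) , _) = ⊢*∈Λ

        open Meet ⊢-of (proj₁ ∘ ⊢-of-InΛ)

        ⊢⊆meet : ∀ {Γ φ} → Γ ⊢ φ → meet Γ φ
        ⊢⊆meet Γ⊢φ =
          let V , V⊆Γ , V⊢φ = IsConsequenceRelation.finitary (IsLogic.isConsequenceRelation ⊢-logic) Γ⊢φ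
          in V , V⊆Γ , resize λ x → proj₂ (⊢-of-InΛ x) V⊢φ

        meetᶠ : L
        meetᶠ = meet ^[ f ] , meet , (meet-isLogic , ⊢⊆meet) , λ Γ φ → mk⇔ id id

        below : ∀ x → x ∈ S → meetᶠ ≼ x
        below x@(_ , _ , _ , s⇔) x∈S {Γ , φ} h = from (s⇔ Γ φ) (meet⇒ h (x , x∈S))

        -- A derivation in ⊢ᵗ of the instance of Γ / φ under fσ uses finitely
        -- many premises, and these are the instances of a finite V within Γ.
        greatest : ∀ l → (∀ x → x ∈ S → l ≼ x) → l ≼ meetᶠ
        greatest (t , ⊢ᵗ , (⊢ᵗ-logic , _) , t⇔) t-lower {Γ , φ} h =
          let W , W⊆ , W⊢φ = finitary (to (t⇔ Γ φ) h)
              V , V⊆Γ , W⊆V = preimages W W⊆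
          in map (_[ fσ ]) V , All.map⁺ (All.map (λ {ψ} ψ∈Γ → ψ , ψ∈Γ , refl) V⊆Γ) ,
             resize λ { (x@(_ , _ , (⊢*-logic , _) , s⇔) , x∈S) →
               let module ⊢* = IsConsequenceRelation (IsLogic.isConsequenceRelation ⊢*-logic) in
               ⊢*.cut (λ { (ψ , ψ∈V , refl) → ⊢*.reflexive (∈-map⁺ (_[ fσ ]) ψ∈V) })
                    (to (s⇔ (_∈ˡ V) φ) (t-lower x x∈S
                      (from (t⇔ (_∈ˡ V) φ) (cut (λ ψ∈W → reflexive (W⊆V ψ∈W)) W⊢φ)))) }
          where
          open IsConsequenceRelation (IsLogic.isConsequenceRelation ⊢ᵗ-logic)

          preimages : ∀ W → All (_∈ (Γ [ fσ ]ˢ)) W →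
                      ∃[ V ] All (_∈ Γ) V × (∀ {χ} → χ ∈ˡ W → χ ∈ ((_∈ˡ V) [ fσ ]ˢ))
          preimages W W⊆ = collect {P = Γ} (λ V χ → χ ∈ ((_∈ˡ V) [ fσ ]ˢ))
            (λ { V⊆W (ψ , ψ∈V , eq) → ψ , V⊆W ψ∈V , eq }) W
            (λ χ∈W → let ψ , ψ∈Γ , eq = All.lookup W⊆ χ∈W
                     in ψ ∷ [] , ψ∈Γ ∷ [] , ψ , here refl , eq)

      Λᶠ-isCompleteLattice : IsCompleteLattice (Λᶠ _⊢_ f)
      Λᶠ-isCompleteLattice = infima⇒completeLattice {lsuc (lsuc ℓ)} (Λᶠ _⊢_ f) Λᶠ-infimum

    -- The dual isomorphism

    module Duality (μ : List (Equation 𝓛 (Fin 1))) {Y : Class 𝓛} (Y-quasi : IsQuasivariety Y)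
                   (idempotent : IsIdempotentIn Y f) where

      -- Validity of a rule under the assignments of fixed points of f.
      Validatesᶠ : Algebra 𝓛 → Pred (Formula 𝓛) ℓ → Formula 𝓛 → Set ℓ
      Validatesᶠ A Γ φ = ∀ v → (∀ p → v p ∈ Fixed f A) → AllDesignated μ A v Γ → Designated μ A (eval A v φ)

      satisfiesᶠ⇔validatesᶠ : ∀ A Γ φ → Satisfiesᶠ μ f A Γ φ ⇔ Validatesᶠ A Γ φ
      satisfiesᶠ⇔validatesᶠ A Γ φ = mk⇔ satisfies⇒validates validates⇒satisfies
        where
        satisfies⇒validates : Satisfiesᶠ μ f A Γ φ → Validatesᶠ A Γ φ
        satisfies⇒validates h v fixed d =
          to (designated-⟨⟩ μ A v φ) (h v fixed (from (designated-[] μ A v Γ) d))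

        validates⇒satisfies : Validatesᶠ A Γ φ → Satisfiesᶠ μ f A Γ φ
        validates⇒satisfies h v fixed d =
          from (designated-⟨⟩ μ A v φ) (h v fixed (to (designated-[] μ A v Γ) d))

      apply-fixed : ∀ {A} → A ∈ Y → ∀ a → apply A a ∈ Fixed f A
      apply-fixed {A} A∈Y a = begin
        apply A (apply A a)                      ≈⟨ apply-cong A apply-a ⟨
        apply A (eval A v (f ⟪ var 0 ⟫))         ≈⟨ eval-[] A v (λ _ → f ⟪ var 0 ⟫) f ⟨
        eval A v (f ⟪ f ⟪ var 0 ⟫ ⟫)             ≈⟨ idempotent 0 A A∈Y v (λ ()) ⟩
        eval A v (f ⟪ var 0 ⟫)                   ≈⟨ apply-a ⟩
        apply A a                                ∎
        where
        open ≈-Reasoning (Algebra.setoid A)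
        v : ℕ → Carrier A
        v _ = a
        apply-a = eval-[] A v (λ _ → var 0) f

      designated-fσ : ∀ A (v : ℕ → Carrier A) φ →
                      Designated μ A (eval A v (φ [ fσ ])) ⇔ Designated μ A (eval A (apply A ∘ v) φ)
      designated-fσ A v φ = mk⇔ (designated-cong μ A (eval-fσ A v φ))
        (designated-cong μ A (Setoid.sym (Algebra.setoid A) (eval-fσ A v φ)))

      designated-fσ-fixed : ∀ A (v : ℕ → Carrier A) → (∀ p → v p ∈ Fixed f A) → ∀ φ →
                            Designated μ A (eval A v (φ [ fσ ])) ⇔ Designated μ A (eval A v φ)
      designated-fσ-fixed A v fixed φ = ⇔-trans (designated-fσ A v φ) (mk⇔
        (designated-cong μ A (eval-agree A φ λ {q} _ → fixed q))
        (designated-cong μ A (Setoid.sym (Algebra.setoid A) (eval-agree A φ λ {q} _ → fixed q))))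

      -- At fixed points of f, a formula and its instance under fσ have equal values.
      models⊆QVarᶠ : ∀ {s _⊩_} → (∀ Γ φ → s Γ φ → (_⊩_ ^[ f ]) Γ φ) → models μ Y _⊩_ ⊆ QVarᶠ Y μ f s
      models⊆QVarᶠ s⇒ {A} (A∈Y , valid) = A∈Y , λ Γ φ sΓφ →
        from (satisfiesᶠ⇔validatesᶠ A Γ φ) λ v fixed d →
          to (designated-fσ-fixed A v fixed φ) (valid _ _ (s⇒ Γ φ sΓφ) v
            λ { (ψ , ψ∈Γ , refl) → from (designated-fσ-fixed A v fixed ψ) (d ψ∈Γ) })

      -- A rule is tested in QVarᶠ only at fixed points of f, and a core superalgebra
      -- has no others than those of its subalgebra.
      core-superalgebra : ∀ {s A} → A ∈ Y → (B : Subalgebra A) → IsCore f A B →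
                          Subalgebra.algebra B ∈ QVarᶠ Y μ f s → A ∈ QVarᶠ Y μ f s
      core-superalgebra {s} {A} A∈Y B (A⊆B , _) (_ , B-valid) = A∈Y , λ Γ φ sΓφ →
        from (satisfiesᶠ⇔validatesᶠ A Γ φ) λ v fixed d →
          let w : ℕ → Carrier (Subalgebra.algebra B)
              w p = v p , proj₁ (A⊆B (fixed p))
          in to (designated-↪ μ (subalgebra-↪ B) w φ)
               (to (satisfiesᶠ⇔validatesᶠ (Subalgebra.algebra B) Γ φ) (B-valid Γ φ sΓφ) w
                  (λ p → proj₂ (A⊆B (fixed p)))
                  λ {ψ} ψ∈Γ → from (designated-↪ μ (subalgebra-↪ B) w ψ) (d ψ∈Γ))

      -- The subalgebra generated by the fixed points of f.
      module Core {A : Algebra 𝓛} (A∈Y : A ∈ Y) where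
        open Setoid (Algebra.setoid A) using () renaming (refl to ≈-refl; sym to ≈-sym; trans to ≈-trans)

        -- The fixed points of f, as variables of terms.
        Generators : Set ℓ
        Generators = ∃ (Fixed f A)

        -- Fixed points exist, as A is nonempty and f idempotent.
        some-generator : Generators
        some-generator = apply A (Algebra.nonempty A) , apply-fixed A∈Y (Algebra.nonempty A)

        -- Its elements are the values of terms in the fixed points.
        core : Subalgebra A
        core = record
          { Universe = λ a → ∃[ t ] A ∋ eval A {X = Generators} proj₁ t ≈ a
          ; resp     = λ { a≈b (t , t≈a) → t , ≈-trans t≈a a≈b }
          ; closed   = λ o as h → op o (tabulate (proj₁ ∘ h)) ,
              Algebra.⟦⟧-cong A o λ j → ≈-trans
                (Setoid.reflexive (Algebra.setoid A) (evals-tabulate A proj₁ (proj₁ ∘ h) j)) (proj₂ (h j))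
          ; nonempty = proj₁ some-generator , var some-generator , ≈-refl
          }

        open Subalgebra core using () renaming (algebra to B)

        core-↪ : B ↪ A
        core-↪ = subalgebra-↪ core

        apply-core : ∀ b → A ∋ proj₁ (apply B b) ≈ apply A (proj₁ b)
        apply-core b = eval-homo B A proj₁ (_↪_.homo core-↪) (λ _ → b) f

        core-isCore : IsCore f A core
        core-isCore =
          (λ {a} fixed → ((var (a , fixed) , ≈-refl)) , ≈-trans (apply-core _) fixed) ,
          (λ { (a∈B , fixed) → ≈-trans (≈-sym (apply-core (_ , a∈B))) fixed })

        -- A rule Γ / φ of the logic is reduced to a finite V within Γ.  An assignment
        -- w into the subalgebra has the form p ↦ t(p) with terms t(p) in the fixed
        -- points.  The terms that result from φ and V under p ↦ t(p) mention finitely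
        -- many fixed points, so these can be renamed to variables: w then becomes a
        -- substitution σ followed by an assignment v of fixed points.  By
        -- substitution-invariance ⊩ derives the instance of V / φ under σ, and the
        -- instance of that under fσ.  So A validates V / φ under σ at v.
        core∈models : ∀ {s _⊩_} → IsLogic _⊩_ → (∀ Γ φ → (_⊩_ ^[ f ]) Γ φ → s Γ φ) →
                      A ∈ QVarᶠ Y μ f s → B ∈ models μ Y _⊩_
        core∈models {s} {_⊩_} logic ⇒s (_ , A-valid) = IsQuasivariety.sub-closed Y-quasi A∈Y core , validates
          where
          open IsLogic logic
          open IsConsequenceRelation isConsequenceRelation

          validates : ∀ Γ φ → Γ ⊩ φ → Validates μ B Γ φ
          validates Γ φ Γ⊩φ w d =
            from (designated-fun μ core-↪ (eval B w φ)) (designated-cong μ A (value (here refl))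
              (to (satisfiesᶠ⇔validatesᶠ A _ _) (A-valid _ _ derivable) v (λ p → proj₂ (ν p))
                λ { (ψ , ψ∈V , refl) → designated-cong μ A (≈-sym (value (there ψ∈V)))
                      (to (designated-fun μ core-↪ (eval B w ψ)) (d (All.lookup V⊆Γ ψ∈V))) }))
            where
            finite = finitary Γ⊩φ
            V   = proj₁ finite
            V⊆Γ = proj₁ (proj₂ finite)
            V⊩φ = proj₂ (proj₂ finite)

            t : ℕ → Term 𝓛 Generators
            t p = proj₁ (proj₂ (w p))

            names : List Generators
            names = concatMap (λ ψ → vars (ψ [ t ])) (φ ∷ V)

            ι : Generators → ℕ
            ι = index some-generator names

            ν : ℕ → Generators
            ν = nth some-generator names

            v : ℕ → Carrier A
            v = proj₁ ∘ ν

            σ : ℕ → Formula 𝓛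
            σ p = t p [ var ∘ ι ]

            derivable : s ((_∈ˡ V) [ σ ]ˢ) (φ [ σ ])
            derivable = ⇒s _ _ (substitution-invariant fσ (substitution-invariant σ V⊩φ))

            value : ∀ {ψ} → ψ ∈ˡ φ ∷ V → A ∋ eval A v (ψ [ σ ]) ≈ proj₁ (eval B w ψ)
            value {ψ} ψ∈ = begin
              eval A v (ψ [ σ ])                    ≈⟨ eval-[] A v σ ψ ⟩
              eval A (eval A v ∘ σ) ψ               ≈⟨ eval-agree A ψ (λ {p} _ → eval-[] A v (var ∘ ι) (t p)) ⟩
              eval A (eval A (v ∘ ι) ∘ t) ψ         ≈⟨ eval-[] A (v ∘ ι) t ψ ⟨
              eval A (v ∘ ι) (ψ [ t ])              ≈⟨ eval-agree A (ψ [ t ]) named ⟩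
              eval A proj₁ (ψ [ t ])                ≈⟨ eval-[] A proj₁ t ψ ⟩
              eval A (eval A proj₁ ∘ t) ψ           ≈⟨ eval-agree A ψ (λ {p} _ → proj₂ (proj₂ (w p))) ⟩
              eval A (proj₁ ∘ w) ψ                  ≈⟨ eval-homo B A proj₁ (_↪_.homo core-↪) w ψ ⟨
              proj₁ (eval B w ψ)                    ∎
              where
              open ≈-Reasoning (Algebra.setoid A)
              named : ∀ {g} → g ∈ˡ vars (ψ [ t ]) → A ∋ v (ι g) ≈ proj₁ g
              named g∈ = Setoid.reflexive (Algebra.setoid A) (cong proj₁
                (nth-index some-generator (∈-concatMap⁺ (λ ψ → vars (ψ [ t ])) (Any.map (λ { refl → g∈ }) ψ∈))))

      -- From left to right the core is the subalgebra generated by the fixed points.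
      QVarᶠ≐↑models : ∀ {s _⊩_} → IsLogic _⊩_ → (∀ Γ φ → s Γ φ ⇔ (_⊩_ ^[ f ]) Γ φ) →
                      QVarᶠ Y μ f s ≐ ↑ Y f (models μ Y _⊩_)
      QVarᶠ≐↑models {s} {_⊩_} logic s⇔ =
        (λ { A∈@(A∈Y , _) → let open Core A∈Y in
               A∈Y , core , core∈models {s} logic (λ Γ φ → from (s⇔ Γ φ)) A∈ , core-isCore }) ,
        (λ { (A∈Y , B , B∈ , B-core) → core-superalgebra {s} A∈Y B B-core
               (models⊆QVarᶠ {s} {_⊩_} (λ Γ φ → to (s⇔ Γ φ)) B∈) })

      ↑-mono : ∀ {K L} → K ⊆ L → ↑ Y f K ⊆ ↑ Y f L
      ↑-mono K⊆L (A∈Y , B , B∈K , B-core) = A∈Y , B , K⊆L B∈K , B-core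

      QVarᶠ-antitone : ∀ {s t : FormulaRel 𝓛} → (∀ Γ φ → s Γ φ → t Γ φ) → QVarᶠ Y μ f t ⊆ QVarᶠ Y μ f s
      QVarᶠ-antitone s⇒t (A∈Y , valid) = A∈Y , λ Γ φ sΓφ → valid Γ φ (s⇒t Γ φ sΓφ)

      module _ {_⊢_ : FormulaRel 𝓛} {Δ : List (Term 𝓛 (Fin 2))} (alg : IsAlgebraizable _⊢_ Y μ Δ) where
        open Algebraizable μ {_⊢_} {Y} {Δ} Y-quasi alg

        -- For completeness of the logic ⊩ that represents t, the instance of Γ / φ
        -- under fσ is tested in the models of ⊩.  An assignment v of the instance
        -- amounts to the assignment p ↦ f(v(p)) of Γ / φ, whose values are fixed
        -- points, and models of ⊩ belong to QVarᶠ of t, hence of s.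
        QVarᶠ-cancel : ∀ {s t} → InΛᶠ _⊢_ f t → QVarᶠ Y μ f t ⊆ QVarᶠ Y μ f s →
                       ∀ Γ φ → s Γ φ → t Γ φ
        QVarᶠ-cancel {s} {t} (_⊩_ , (logic , ⊢⊆⊩) , t⇔) t⊆s Γ φ sΓφ =
          from (t⇔ Γ φ) (Lindenbaum.completeness logic ⊢⊆⊩ (Γ [ fσ ]ˢ) valid)
          where
          valid : logicOf μ (models μ Y _⊩_) (Γ [ fσ ]ˢ) (φ [ fσ ])
          valid A A∈@(A∈Y , _) v d = from (designated-fσ A v φ)
            (to (satisfiesᶠ⇔validatesᶠ A Γ φ)
                (proj₂ (t⊆s (models⊆QVarᶠ {t} {_⊩_} (λ Γ φ → to (t⇔ Γ φ)) A∈)) Γ φ sΓφ)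
                (apply A ∘ v) (λ p → apply-fixed A∈Y (v p))
                λ {ψ} ψ∈Γ → to (designated-fσ A v ψ) (d (ψ , ψ∈Γ , refl)))

        QVarᶠ∈Ξᶠ : ∀ s → InΛᶠ _⊢_ f s → InΞᶠ Y f (QVarᶠ Y μ f s)
        QVarᶠ∈Ξᶠ s (_⊩_ , (logic , _) , s⇔) = models μ Y _⊩_ ,
          (models-isQuasivariety μ Y-quasi (IsLogic.isConsequenceRelation logic) , proj₁) ,
          QVarᶠ≐↑models {s} logic s⇔

        logicOf∈Λ : ∀ {K} → InΞ Y K → InΛ _⊢_ (logicOf μ K)
        logicOf∈Λ (K-quasi , K⊆Y) = logicOf-isLogic μ K-quasi ,
          λ {Γ} {φ} Γ⊢φ A A∈K → ⊢⇒logicOf {Γ} {φ} Γ⊢φ A (K⊆Y A∈K)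

        -- The members of QVarᶠ of the f-logic of K are the core superalgebras of
        -- members of K, as K is the class of models of its logic.
        QVarᶠ-logicOf : ∀ {K} → InΞ Y K → QVarᶠ Y μ f (logicOf μ K ^[ f ]) ≐ ↑ Y f K
        QVarᶠ-logicOf {K} K∈Ξ@(K-quasi , K⊆Y) =
          (λ A∈ → ↑-mono {models μ Y (logicOf μ K)} {K} (models-logicOf K-quasi K⊆Y) (proj₁ q A∈)) ,
          (λ A∈ → proj₂ q (↑-mono {K} {models μ Y (logicOf μ K)} K⊆models A∈))
          where
          K⊆models : K ⊆ models μ Y (logicOf μ K)
          K⊆models A∈K = K⊆Y A∈K , λ Γ φ valid → valid _ A∈K

          q = QVarᶠ≐↑models {logicOf μ K ^[ f ]} (logicOf-isLogic μ K-quasi) (λ Γ φ → mk⇔ id id)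

        dualIsomorphism : QVarᶠIsDualIsomorphism _⊢_ Y μ f
        dualIsomorphism = QVarᶠ∈Ξᶠ , record
          { isOrderMonomorphism = record
            { isOrderHomomorphism = record { cong = λ {x} {y} → q-cong {x} {y} ; mono = λ {x} {y} → mono {x} {y} }
            ; injective = λ {x} {y} (p , q) → cancel {x} {y} q , cancel {y} {x} p
            ; cancel    = λ {x} {y} → cancel {x} {y}
            }
          ; surjective = λ { (L , K , K∈Ξ , L⊆ , L⊇) →
              logicOfᶠ K∈Ξ , λ {z} z≈ →
                let z⊆ , z⊇ = q-cong {z} {logicOfᶠ K∈Ξ} z≈
                    q⊆ , q⊇ = QVarᶠ-logicOf K∈Ξ
                in (λ A∈ → L⊇ (q⊆ (z⊆ A∈))) , (λ A∈ → z⊇ (q⊇ (L⊆ A∈))) }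
          }
          where
          module Λ = Poset (Λᶠ _⊢_ f)
          module Ξ = Poset (Ξᶠ Y f)

          logicOfᶠ : ∀ {K} → InΞ Y K → Λ.Carrier
          logicOfᶠ {K} K∈Ξ = logicOf μ K ^[ f ] , logicOf μ K , logicOf∈Λ K∈Ξ , λ Γ φ → mk⇔ id id

          image : Λ.Carrier → Ξ.Carrier
          image (s , s∈Λᶠ) = QVarᶠ Y μ f s , QVarᶠ∈Ξᶠ s s∈Λᶠ

          mono : ∀ {x y} → x Λ.≤ y → image x Ξ.≥ image y
          mono {s , _} {t , _} s⊆t = QVarᶠ-antitone {s} {t} λ Γ φ → s⊆t {Γ , φ}

          cancel : ∀ {x y} → image x Ξ.≥ image y → x Λ.≤ y
          cancel {s , _} {t , t∈} t⊆s {Γ , φ} = QVarᶠ-cancel {s} {t} t∈ t⊆s Γ φ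

          q-cong : ∀ {x y} → x Λ.≈ y → image x Ξ.≈ image y
          q-cong {x} {y} (x≤y , y≤x) = mono {y} {x} y≤x , mono {x} {y} x≤y

corollary3p27 : (∀ {a : Level} → ExcludedMiddle a) →
    ∀ {ℓ : Level} (𝓛 : Language ℓ)
    (_⊢_ : FormulaRel 𝓛) (Y : Class 𝓛)
    (μ : List (Equation 𝓛 (Fin 1))) (Δ : List (Term 𝓛 (Fin 2)))
    (f : Term 𝓛 (Fin 1)) →
    IsLogic _⊢_ →
    IsQuasivariety Y →
    IsAlgebraizable _⊢_ Y μ Δ →
    IsSelector _⊢_ f →
    IsIdempotentIn Y f →
    IsCompleteLattice (Λᶠ _⊢_ f) ×
    IsCompleteLattice (Ξᶠ Y f) ×
    QVarᶠIsDualIsomorphism _⊢_ Y μ f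
corollary3p27 em {ℓ} 𝓛 _⊢_ Y μ Δ f ⊢-logic Y-quasi alg _ idempotent =
  Λᶠ-complete ,
  dualIsomorphism⇒completeLattice {lsuc (lsuc ℓ)} (Λᶠ _⊢_ f) (Ξᶠ Y f) (proj₂ duality) Λᶠ-complete ,
  duality
  where
  Λᶠ-complete : IsCompleteLattice (Λᶠ _⊢_ f)
  Λᶠ-complete = Selector.Λᶠ-isCompleteLattice em f ⊢-logic

  duality : QVarᶠIsDualIsomorphism _⊢_ Y μ f
  duality = Selector.Duality.dualIsomorphism em f μ Y-quasi idempotent {_⊢_} {Δ} alg
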